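{- For any integer $n\ge 0$, we have \[\mathrm{pod}_{ -3}(3n+2)\equiv 6\,\mathrm{pod}(9n+5) \pmod{9},\] \[\mathrm{pod}_{ -3}(3n+1)\equiv 3\,\mathrm{pod}(9n+2) \pmod{18}.\]
   Context: $\mathrm{pod}(n)$ denotes the number of partitions of $n$ in which the odd parts are distinct, and $\mathrm{pod}_{ -3}(n)$ denotes the number of partition triples of $n$ in which the odd parts in each of the three partitions are distinct. Equivalently, as formal power series, \[\sum_{n=0}^{\infty}\mathrm{pod}(n)q^n=\frac{(-q;q^2)_\infty}{(q^2;q^2)_\infty}=\frac{1}{\psi(-q)},\qquad \sum_{n=0}^{\infty}\mathrm{pod}_{ -3}(n)q^n=\frac{(-q;q^2)_\infty^3}{(q^2;q^2)_\infty^3}=\frac{1}{\psi(-q)^3},\] where $\psi(q)=\sum_{n=0}^{\infty}q^{n(n+1)/2}$ and $(a;q)_\infty=\prod_{k\ge 0}(1-aq^k)$. -}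

module Defs where

open import Data.List.Base
  using (List; []; _∷_; length; filter; upTo; cartesianProduct; cartesianProductWith)
open import Data.List.Membership.Propositional using (_∈_)
open import Data.List.Membership.Propositional.Properties
  using (∈-filter⁺; ∈-filter⁻; ∈-upTo⁺; ∈-cartesianProduct⁺;
         ∈-cartesianProductWith⁺; ∈-cartesianProductWith⁻)
open import Data.List.Properties using (∷-injective)
open import Data.List.Relation.Unary.All as All using (All; all?; []; _∷_)
open import Data.List.Relation.Unary.AllPairs using ([]; _∷_)
open import Data.List.Relation.Unary.Any using (here; there)
open import Data.List.Relation.Unary.Linked using (Linked; linked?)
open import Data.List.Relation.Unary.Unique.Propositional using (Unique)
import Data.List.Relation.Unary.Unique.Propositional.Properties as Unique
open import Data.Nat.Base using (ℕ; zero; suc; _+_; _≤_; _<_; _≥_; s≤s; z≤n)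
open import Data.Nat.Divisibility using (_∣_; _∣?_)
open import Data.Nat.ListAction using (sum)
open import Data.Nat.Properties
  using (_≟_; _≥?_; _<?_; ≤-refl; ≤-trans; +-mono-≤; m≤m+n; m≤n+m)
open import Data.List.Relation.Unary.Unique.DecPropositional _≟_ using (unique?)
open import Data.Product.Base using (_×_; _,_; proj₂)
open import Function.Base using (_∘_)
open import Function.Bundles using (_⇔_; mk⇔)
open import Relation.Binary.PropositionalEquality using (_≡_; refl)
open import Relation.Nullary.Decidable using (_×-dec_; ¬?)
open import Relation.Nullary.Negation.Core using (¬_)
open import Relation.Unary using (Decidable)

Odd : ℕ → Set
Odd k = ¬ (2 ∣ k)

odd? : Decidable Odd
odd? k = ¬? (2 ∣? k)

IsPartition : List ℕ → Set
IsPartition ps = Linked _≥_ ps × All (0 <_) ps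

OddPartsDistinct : List ℕ → Set
OddPartsDistinct ps = Unique (filter odd? ps)

IsPod : List ℕ → Set
IsPod ps = IsPartition ps × OddPartsDistinct ps

isPod? : Decidable IsPod
isPod? ps =
  (linked? _≥?_ ps ×-dec all? (0 <?_) ps) ×-dec unique? (filter odd? ps)

IsPodOf : ℕ → List ℕ → Set
IsPodOf n ps = IsPod ps × sum ps ≡ n

isPodOf? : ∀ n → Decidable (IsPodOf n)
isPodOf? n ps = isPod? ps ×-dec (sum ps ≟ n)

Triple : Set
Triple = List ℕ × List ℕ × List ℕ

IsPodTripleOf : ℕ → Triple → Set
IsPodTripleOf n (ps , qs , rs) =
  (IsPod ps × IsPod qs × IsPod rs) × sum ps + (sum qs + sum rs) ≡ n

isPodTripleOf? : ∀ n → Decidable (IsPodTripleOf n)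
isPodTripleOf? n (ps , qs , rs) =
  (isPod? ps ×-dec isPod? qs ×-dec isPod? rs)
    ×-dec (sum ps + (sum qs + sum rs) ≟ n)

-- All lists of length at most k with entries drawn from xs.
listsUpTo : {A : Set} → ℕ → List A → List (List A)
listsUpTo zero    xs = [] ∷ []
listsUpTo (suc k) xs = [] ∷ cartesianProductWith _∷_ xs (listsUpTo k xs)

-- A partition of some m ≤ n has at most n parts, each at most n, so it is
-- listed here.
candidates : ℕ → List (List ℕ)
candidates n = listsUpTo n (upTo (suc n))

podPartitions : ℕ → List (List ℕ)
podPartitions n = filter (isPodOf? n) (candidates n)

podTriples : ℕ → List Triple
podTriples n = filter (isPodTripleOf? n)
  (cartesianProduct (candidates n) (cartesianProduct (candidates n) (candidates n)))

pod : ℕ → ℕ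
pod n = length (podPartitions n)

pod₋₃ : ℕ → ℕ
pod₋₃ n = length (podTriples n)

-- The two enumerations are complete and free of repetitions, so that the
-- lengths above are the intended cardinalities.

private
  ∈-listsUpTo : ∀ {A : Set} {k} {xs ys : List A} →
                length ys ≤ k → All (_∈ xs) ys → ys ∈ listsUpTo k xs
  ∈-listsUpTo {k = zero}  {ys = []}     _       _        = here refl
  ∈-listsUpTo {k = suc k} {ys = []}     _       _        = here refl
  ∈-listsUpTo {k = suc k} {ys = y ∷ ys} (s≤s l) (p ∷ ps) =
    there (∈-cartesianProductWith⁺ _∷_ p (∈-listsUpTo l ps))

  []∉ : ∀ {A : Set} (xs : List A) (yss : List (List A)) →
        ¬ ([] ∈ cartesianProductWith {C = List A} _∷_ xs yss)
  []∉ xs yss []∈ with ∈-cartesianProductWith⁻ _∷_ xs yss []∈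
  ... | _ , _ , _ , _ , ()

  listsUpTo-unique : ∀ {A : Set} k {xs : List A} → Unique xs → Unique (listsUpTo k xs)
  listsUpTo-unique zero    _ = [] ∷ []
  listsUpTo-unique (suc k) {xs} u =
    All.tabulate (λ { z∈ refl → []∉ xs (listsUpTo k xs) z∈ })
      ∷ Unique.cartesianProductWith⁺ _∷_ ∷-injective u (listsUpTo-unique k u)

  candidates-unique : ∀ n → Unique (candidates n)
  candidates-unique n = listsUpTo-unique n (Unique.upTo⁺ (suc n))

  length≤sum : ∀ {ps} → All (0 <_) ps → length ps ≤ sum ps
  length≤sum []       = z≤n
  length≤sum (p ∷ ps) = +-mono-≤ p (length≤sum ps)

  parts≤sum : ∀ ps → All (_≤ sum ps) ps
  parts≤sum []       = []
  parts≤sum (p ∷ ps) =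
    m≤m+n p (sum ps) ∷ All.map (λ q≤ → ≤-trans q≤ (m≤n+m (sum ps) p)) (parts≤sum ps)

  ∈-candidates : ∀ {n ps} → IsPod ps → sum ps ≤ n → ps ∈ candidates n
  ∈-candidates {ps = ps} ((_ , pos) , _) s≤n = ∈-listsUpTo
    (≤-trans (length≤sum pos) s≤n)
    (All.map (λ q≤ → ∈-upTo⁺ (s≤s (≤-trans q≤ s≤n))) (parts≤sum ps))

∈-podPartitions : ∀ {n ps} → ps ∈ podPartitions n ⇔ IsPodOf n ps
∈-podPartitions {n} = mk⇔
  (proj₂ ∘ ∈-filter⁻ (isPodOf? n) {xs = candidates n})
  λ { h@(isPod , refl) → ∈-filter⁺ (isPodOf? n) (∈-candidates isPod ≤-refl) h }

podPartitions-unique : ∀ n → Unique (podPartitions n)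
podPartitions-unique n = Unique.filter⁺ (isPodOf? n) (candidates-unique n)

∈-podTriples : ∀ {n t} → t ∈ podTriples n ⇔ IsPodTripleOf n t
∈-podTriples {n} {ps , qs , rs} = mk⇔
  (proj₂ ∘ ∈-filter⁻ (isPodTripleOf? n)
    {xs = cartesianProduct (candidates n)
            (cartesianProduct (candidates n) (candidates n))})
  λ { h@((p , q , r) , refl) → ∈-filter⁺ (isPodTripleOf? n)
        (∈-cartesianProduct⁺ (∈-candidates p (m≤m+n _ _))
          (∈-cartesianProduct⁺
            (∈-candidates q (≤-trans (m≤m+n _ _) (m≤n+m _ (sum ps))))
            (∈-candidates r (≤-trans (m≤n+m _ (sum qs)) (m≤n+m _ (sum ps))))))
        h }

podTriples-unique : ∀ n → Unique (podTriples n)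
podTriples-unique n = Unique.filter⁺ (isPodTripleOf? n)
  (Unique.cartesianProduct⁺ (candidates-unique n)
    (Unique.cartesianProduct⁺ (candidates-unique n) (candidates-unique n)))

{-# OPTIONS --safe #-}

-- Let ψ = Σ (-q)^{k(k+1)/2}, so that P = 1/ψ enumerates pod and P³ enumerates pod₋₃
-- (Gauss, proved through Shanks' finite identity). Sorting triangular numbers mod 3 gives
-- ψ = α(q³) - q b(q³) with b = ψ(q³). Hence the three sections p₀, p₁, p₂ of P mod 3 satisfy
-- pᵢ D = α², αb, b² with D = α³ - q b³, while the sections 1 and 2 of P³ are 3 W₁ and 3 W₂ for
-- explicit polynomials W₁ and W₂ in the pᵢ.
--   Modulo 3, the Frobenius f³ ≡ f(q³) gives D ≡ ψ and b ≡ ψ³, so that W₁, W₂ and the sections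
-- of p₂ all become monomials in α, b and ψ.
--   Modulo 2, the pentagonal number theorem gives α³ ≡ ψ. The series E = ψ⁴ + ψb + q b⁴ then
-- satisfies E ≡ q E(q³), whence E ≡ 0; that is D b ≡ ψ⁴, which again makes D invertible.
module Submission where

-- The factor 3 in front of `W₁` and `W₂` lowers the moduli: 18 and 9 become 6 and 3, and 6 splits
-- into 2 and 3, so only characteristics 2 and 3 have to be studied. The factor comes from counting
-- residues: three residues modulo 3 whose sum is 1 or 2 are neither all equal nor all different, so
-- each choice occurs in exactly three orders. As this 3 is split off before reducing further, `W₁`
-- and `W₂` must be the same integers for every modulus. Hence every coefficient ring has carrier ℤ,
-- and only its equality depends on the modulus. `D` is the determinant of multiplication by ψ
-- acting on the three sections, and the formulas for the pᵢ are Cramer's rule. Its constant term is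
-- 1, so an inverse exists over any ring; the difficulty is a closed form for that inverse in which
-- both sides can be compared. It is `P` modulo 3 and `b` P⁴ modulo 2. Infinite products never
-- occur: a finite identity holds for each n, and all but one of the terms on its right vanish
-- modulo qⁿ.

open import Defs
open import Algebra.Bundles using (CommutativeRing)
import Algebra.Properties.Ring
import Algebra.Properties.Semiring.Exp
import Algebra.Properties.Semiring.Mult.TCOptimised
import Algebra.Solver.Ring
open import Algebra.Solver.Ring.AlmostCommutativeRing
  using (_-Raw-AlmostCommutative⟶_; fromCommutativeRing)
open import Data.Integer.Base as ℤ using (ℤ; +_; -[1+_]; _⊖_)
import Data.Integer.DivMod as ℤ
open import Data.Integer.Divisibility.Signed as ℤ
  using (divides; ∣m∣n⇒∣m+n; ∣m⇒∣-m; ∣m⇒∣m*n; ∣n⇒∣m*n; ∣⇒∣ᵤ; *-monoʳ-∣)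
import Data.Integer.Properties as ℤ
import Data.Integer.Solver
open import Data.List.Base using (List; []; _∷_; _++_; map; length; filter; cartesianProduct)
open import Data.List.Membership.Propositional using (_∈_)
open import Data.List.Membership.Propositional.Properties
  using (∈-filter⁺; ∈-filter⁻; ∈-map⁺; ∈-map⁻; ∈-++⁺ˡ; ∈-++⁺ʳ; ∈-++⁻;
         ∈-cartesianProduct⁺; ∈-cartesianProduct⁻)
open import Data.List.Membership.Propositional.Properties.WithK using (unique∧set⇒bag)
open import Data.List.Properties
  using (length-map; length-++; filter-accept; filter-reject; ∷-injectiveʳ)
open import Data.List.Relation.Binary.BagAndSetEquality using (∼bag⇒↭)
open import Data.List.Relation.Binary.Permutation.Propositional.Properties using (↭-length)
open import Data.List.Relation.Unary.All as All using (All; all?; []; _∷_)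
open import Data.List.Relation.Unary.AllPairs using ([]; _∷_)
open import Data.List.Relation.Unary.Linked as Linked using (Linked; [-]; _∷_)
open import Data.List.Relation.Unary.Linked.Properties using (Linked⇒AllPairs)
open import Data.List.Relation.Unary.Unique.Propositional using (Unique)
import Data.List.Relation.Unary.Unique.Propositional.Properties as Unique
open import Data.Maybe.Base as Maybe using (Maybe)
open import Data.Nat.Base as ℕ
  using (ℕ; zero; suc; z≤n; s≤s; _≤_; _<_; _≥_; NonZero; _%_)
import Data.Nat.Divisibility as ℕ
open import Data.Nat.DivMod using ([m+kn]%n≡m%n)
open import Data.Nat.ListAction using (sum)
import Data.Nat.Properties as ℕ
import Data.Nat.Solver
open import Data.Product.Base using (_,_; ∃₂; proj₁; proj₂)
open import Data.Sum.Base using (inj₁; inj₂)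
open import Function.Base using (_∘_)
open import Function.Bundles using (_⇔_; mk⇔; Equivalence)
open import Level using (0ℓ)
open import Relation.Binary.PropositionalEquality as ≡ using (_≡_)
import Relation.Binary.Reasoning.Setoid
open import Relation.Nullary.Decidable using (yes; no; dec⇒maybe)
open import Relation.Nullary.Negation.Core using (¬_; contradiction)

-- Integer coefficients in an arbitrary commutative ring

module IntegerSolver (R : CommutativeRing 0ℓ 0ℓ) where
  open CommutativeRing R
  open Algebra.Properties.Ring ring
  open Algebra.Properties.Semiring.Mult.TCOptimised semiring
  open Relation.Binary.Reasoning.Setoid setoid

  -- With the optimised multiple, the images of 1, 2 and 3 unfold to `1#`, `1# + 1#` and
  -- `1# + 1# + 1#`. A coefficient 2 or 3 produced by the solver can thus be fed directly to
  -- `drop-double` or `drop-triple`.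
  fromℤ : ℤ → Carrier
  fromℤ (+ n)    = n × 1#
  fromℤ -[1+ n ] = - (suc n × 1#)

  x+y-[x+z] : ∀ x y z → (x + y) - (x + z) ≈ y - z
  x+y-[x+z] x y z = begin
    (x + y) - (x + z)      ≈⟨ +-cong (+-comm x y) (sym (-‿+-comm x z)) ⟩
    (y + x) + (- x - z)    ≈⟨ +-assoc y x (- x - z) ⟩
    y + (x + (- x - z))    ≈⟨ +-congˡ (+-assoc x (- x) (- z)) ⟨
    y + ((x - x) - z)      ≈⟨ +-congˡ (+-congʳ (-‿inverseʳ x)) ⟩
    y + (0# - z)           ≈⟨ +-congˡ (+-identityˡ (- z)) ⟩
    y - z                  ∎

  fromℤ-⊖ : ∀ m n → fromℤ (m ⊖ n) ≈ m × 1# - n × 1#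
  fromℤ-⊖ zero    zero    = sym (-‿inverseʳ 0#)
  fromℤ-⊖ zero    (suc n) = sym (+-identityˡ _)
  fromℤ-⊖ (suc m) zero    = sym (trans (+-congˡ -0#≈0#) (+-identityʳ _))
  fromℤ-⊖ (suc m) (suc n) = begin
    fromℤ (suc m ⊖ suc n)     ≡⟨ ≡.cong fromℤ (ℤ.[1+m]⊖[1+n]≡m⊖n m n) ⟩
    fromℤ (m ⊖ n)             ≈⟨ fromℤ-⊖ m n ⟩
    m × 1# - n × 1#           ≈⟨ x+y-[x+z] 1# _ _ ⟨
    (1# + m × 1#) - (1# + n × 1#) ≈⟨ +-cong (1+× m 1#) (-‿cong (1+× n 1#)) ⟨
    suc m × 1# - suc n × 1#   ∎

  fromℤ-+ : ∀ i j → fromℤ (i ℤ.+ j) ≈ fromℤ i + fromℤ j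
  fromℤ-+ (+ m)    (+ n)    = ×-homo-+ 1# m n
  fromℤ-+ (+ m)    -[1+ n ] = fromℤ-⊖ m (suc n)
  fromℤ-+ -[1+ m ] (+ n)    = trans (fromℤ-⊖ n (suc m)) (+-comm _ _)
  fromℤ-+ -[1+ m ] -[1+ n ] = begin
    - (suc (suc (m ℕ.+ n)) × 1#)        ≡⟨ ≡.cong (λ k → - (k × 1#)) (ℕ.+-suc (suc m) n) ⟨
    - ((suc m ℕ.+ suc n) × 1#)          ≈⟨ -‿cong (×-homo-+ 1# (suc m) (suc n)) ⟩
    - (suc m × 1# + suc n × 1#)         ≈⟨ -‿+-comm _ _ ⟨
    - (suc m × 1#) - suc n × 1#         ∎

  fromℤ-neg : ∀ i → fromℤ (ℤ.- i) ≈ - fromℤ i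
  fromℤ-neg (+ zero)  = sym -0#≈0#
  fromℤ-neg (+ suc n) = refl
  fromℤ-neg -[1+ n ]  = sym (-‿involutive _)

  fromℤ-+* : ∀ m j → fromℤ (+ m ℤ.* j) ≈ m × 1# * fromℤ j
  fromℤ-+* m (+ n) = begin
    fromℤ (+ m ℤ.* + n)  ≡⟨ ≡.cong fromℤ (ℤ.pos-* m n) ⟨
    (m ℕ.* n) × 1#       ≈⟨ ×1-homo-* m n ⟩
    m × 1# * n × 1#      ∎
  fromℤ-+* m -[1+ n ] = begin
    fromℤ (+ m ℤ.* ℤ.- (+ suc n))   ≡⟨ ≡.cong fromℤ (ℤ.neg-distribʳ-* (+ m) (+ suc n)) ⟨
    fromℤ (ℤ.- (+ m ℤ.* + suc n))   ≈⟨ fromℤ-neg (+ m ℤ.* + suc n) ⟩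
    - fromℤ (+ m ℤ.* + suc n)       ≈⟨ -‿cong (fromℤ-+* m (+ suc n)) ⟩
    - (m × 1# * suc n × 1#)         ≈⟨ -‿distribʳ-* _ _ ⟩
    m × 1# * - (suc n × 1#)         ∎

  fromℤ-* : ∀ i j → fromℤ (i ℤ.* j) ≈ fromℤ i * fromℤ j
  fromℤ-* (+ m)    j = fromℤ-+* m j
  fromℤ-* -[1+ m ] j = begin
    fromℤ (ℤ.- (+ suc m) ℤ.* j)    ≡⟨ ≡.cong fromℤ (ℤ.neg-distribˡ-* (+ suc m) j) ⟨
    fromℤ (ℤ.- (+ suc m ℤ.* j))    ≈⟨ fromℤ-neg (+ suc m ℤ.* j) ⟩
    - fromℤ (+ suc m ℤ.* j)        ≈⟨ -‿cong (fromℤ-+* (suc m) j) ⟩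
    - (suc m × 1# * fromℤ j)       ≈⟨ -‿distribˡ-* _ _ ⟩
    - (suc m × 1#) * fromℤ j       ∎

  fromℤ-homomorphism : ℤ.+-*-rawRing -Raw-AlmostCommutative⟶ fromCommutativeRing R
  fromℤ-homomorphism = record
    { ⟦_⟧    = fromℤ
    ; +-homo = fromℤ-+
    ; *-homo = fromℤ-*
    ; -‿homo = fromℤ-neg
    ; 0-homo = refl
    ; 1-homo = refl
    }

  -- Deliberately incomplete: different integers may agree in the ring, but the ring's own equality
  -- need not be decidable. Identities special to characteristic 2 or 3 are therefore stated with an
  -- explicit multiple of 2 or 3, discarded afterwards.
  fromℤ-≟ : ∀ i j → Maybe (fromℤ i ≈ fromℤ j)
  fromℤ-≟ i j = Maybe.map (λ { ≡.refl → refl }) (dec⇒maybe (i ℤ.≟ j))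

  open Algebra.Solver.Ring ℤ.+-*-rawRing (fromCommutativeRing R) fromℤ-homomorphism fromℤ-≟ public
    using (solve; _:=_; _:+_; _:*_; _:-_; :-_; con)

-- Finite theta identities

tri : ℕ → ℕ
tri zero    = 0
tri (suc n) = suc n ℕ.+ tri n

-- The generalised pentagonal numbers k(3k+1)/2 and (k+1)(3k+2)/2, k ≥ 0.
pent₁ pent₂ : ℕ → ℕ
pent₁ zero    = 0
pent₁ (suc k) = suc k ℕ.+ pent₂ k
pent₂ k       = suc (k ℕ.* 2) ℕ.+ pent₁ k

module _ where
  open Data.Nat.Solver.+-*-Solver
  open ≡.≡-Reasoning

  tri-double : ∀ n → tri (n ℕ.* 2) ≡ suc (n ℕ.* 2) ℕ.* n
  tri-double zero    = ≡.refl
  tri-double (suc n) = ≡.trans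
    (≡.cong (λ t → suc (suc (n ℕ.* 2)) ℕ.+ (suc (n ℕ.* 2) ℕ.+ t)) (tri-double n))
    (solve 1 (λ n → (con 2 :+ n :* con 2) :+ ((con 1 :+ n :* con 2) :+ (con 1 :+ n :* con 2) :* n)
                 := (con 3 :+ n :* con 2) :* (con 1 :+ n)) ≡.refl n)

  pent₁-tri : ∀ n → pent₁ n ≡ n ℕ.* n ℕ.+ tri n
  pent₁-tri zero    = ≡.refl
  pent₁-tri (suc n) = ≡.trans
    (≡.cong (λ t → suc n ℕ.+ (suc (n ℕ.* 2) ℕ.+ t)) (pent₁-tri n))
    (solve 2 (λ n t → (con 1 :+ n) :+ ((con 1 :+ n :* con 2) :+ (n :* n :+ t))
                   := (con 1 :+ n) :* (con 1 :+ n) :+ ((con 1 :+ n) :+ t)) ≡.refl n (tri n))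

  pent₂-tri : ∀ n → pent₂ n ≡ n ℕ.* suc n ℕ.+ tri (suc n)
  pent₂-tri n = ≡.trans
    (≡.cong (suc (n ℕ.* 2) ℕ.+_) (pent₁-tri n))
    (solve 2 (λ n t → (con 1 :+ n :* con 2) :+ (n :* n :+ t)
                   := n :* (con 1 :+ n) :+ ((con 1 :+ n) :+ t)) ≡.refl n (tri n))

module FiniteIdentities (R : CommutativeRing 0ℓ 0ℓ) where
  open CommutativeRing R
  open Algebra.Properties.Ring ring
  open Algebra.Properties.Semiring.Exp semiring
  open IntegerSolver R
  open Relation.Binary.Reasoning.Setoid setoid

  ∑ : (ℕ → Carrier) → ℕ → Carrier
  ∑ f zero    = 0#
  ∑ f (suc n) = ∑ f n + f n

  ∑-cong : ∀ {f g} → (∀ n → f n ≈ g n) → ∀ n → ∑ f n ≈ ∑ g n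
  ∑-cong f≈g zero    = refl
  ∑-cong f≈g (suc n) = +-cong (∑-cong f≈g n) (f≈g n)

  *-∑ : ∀ c f n → c * ∑ f n ≈ ∑ (λ k → c * f k) n
  *-∑ c f zero    = zeroʳ c
  *-∑ c f (suc n) = trans (distribˡ c _ _) (+-congʳ (*-∑ c f n))

  triSum : Carrier → ℕ → Carrier
  triSum x = ∑ (λ k → x ^ tri k)

  pentSum : Carrier → ℕ → Carrier
  pentSum x = ∑ (λ k → x ^ pent₁ k + x ^ pent₂ k)

  ^-distrib-* : ∀ x y n → (x * y) ^ n ≈ x ^ n * y ^ n
  ^-distrib-* x y zero    = sym (*-identityˡ 1#)
  ^-distrib-* x y (suc n) = begin
    x * y * (x * y) ^ n         ≈⟨ *-congˡ (^-distrib-* x y n) ⟩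
    x * y * (x ^ n * y ^ n)     ≈⟨ solve 4 (λ x y u v → x :* y :* (u :* v) := x :* u :* (y :* v)) refl x y _ _ ⟩
    x * x ^ n * (y * y ^ n)     ∎

  -- Shanks' finite form of Gauss' identity
  -- ∑ x^{k(k+1)/2} = ∏ (1 - x^{2k}) / (1 - x^{2k-1}).
  module Gauss (x : Carrier) (r : ℕ → Carrier)
    (r-suc : ∀ n → r (suc n) * (1# - x ^ (suc n ℕ.* 2)) ≈ r n * (1# - x ^ suc (n ℕ.* 2)))
    (cancel : ∀ n {u v} → (1# - x ^ (suc n ℕ.* 2)) * u ≈ (1# - x ^ (suc n ℕ.* 2)) * v → u ≈ v)
    where

    -- Put T(s) = r s (1 - x^(2s+1)) y^(s+1). By `r-suc`, T(s-1) = r s (1 - x^(2s)) y^s, and the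
    -- difference of the two s-th summands is T(s) - T(s-1), with T(-1) = 0.
    telescope : ∀ y m →
      ∑ (λ s → r s * ((1# - x * y) * (y ^ s * x ^ (s ℕ.* 2)))) (suc m) ≈
      ∑ (λ s → (1# - y) * (r s * y ^ s)) (suc m) + r m * (1# - x ^ suc (m ℕ.* 2)) * y ^ suc m
    telescope y zero = solve 3 (λ x y r →
      con (+ 0) :+ r :* ((con (+ 1) :- x :* y) :* (con (+ 1) :* con (+ 1))) :=
      con (+ 0) :+ (con (+ 1) :- y) :* (r :* con (+ 1)) :+ r :* (con (+ 1) :- x :* con (+ 1)) :* (y :* con (+ 1)))
      refl x y (r 0)
    telescope y (suc m) = begin
      _ ≈⟨ +-congʳ (telescope y m) ⟩
      _ ≈⟨ +-congʳ (+-congˡ (*-congʳ (r-suc m))) ⟨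
      _ ≈⟨ solve 6 (λ x y z Y r S →
             S :+ r :* (con (+ 1) :- x :* (x :* z)) :* (y :* Y)
               :+ r :* ((con (+ 1) :- x :* y) :* ((y :* Y) :* (x :* (x :* z)))) :=
             S :+ (con (+ 1) :- y) :* (r :* (y :* Y))
               :+ r :* (con (+ 1) :- x :* (x :* (x :* z))) :* (y :* (y :* Y)))
             refl x y (x ^ (m ℕ.* 2)) (y ^ m) (r (suc m)) (∑ (λ s → (1# - y) * (r s * y ^ s)) (suc m)) ⟩
      _ ∎

    x²y^ : ∀ y s → (x * (x * y)) ^ s ≈ y ^ s * x ^ (s ℕ.* 2)
    x²y^ y zero    = sym (*-identityˡ 1#)
    x²y^ y (suc s) = trans (*-congˡ (x²y^ y s))
      (solve 4 (λ x y Y z → x :* (x :* y) :* (Y :* z) := y :* Y :* (x :* (x :* z))) refl x y _ _)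

    -- With y = x^(2n+1), the two new triangular exponents contribute y^n and y^(n+1). Multiplying
    -- by 1 - xy turns `r (suc n)` into `r n` (1 - y); then y^n supplies the summand s = n, and
    -- y^(n+1) is the boundary term of `telescope`.
    shanks : ∀ n → r n * triSum x (n ℕ.* 2) ≈ ∑ (λ s → r s * (x ^ suc (n ℕ.* 2)) ^ s) n
    shanks zero    = zeroʳ (r 0)
    shanks (suc n) = cancel n (begin
      (1# - x * y) * (r (suc n) * (ψ + x ^ tri (n ℕ.* 2) + x ^ tri (suc (n ℕ.* 2))))
        ≈⟨ *-congˡ (*-congˡ (+-cong (+-congˡ t≈) t′≈)) ⟩
      (1# - x * y) * (r (suc n) * (ψ + y ^ n + y ^ suc n))
        ≈⟨ solve 3 (λ r e ψ → e :* (r :* ψ) := (r :* e) :* ψ) refl (r (suc n)) (1# - x * y) _ ⟩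
      r (suc n) * (1# - x * y) * (ψ + y ^ n + y ^ suc n)
        ≈⟨ *-congʳ (r-suc n) ⟩
      r n * (1# - y) * (ψ + y ^ n + y ^ suc n)
        ≈⟨ solve 5 (λ r o ψ a b → r :* o :* (ψ :+ a :+ b) := o :* (r :* ψ) :+ o :* (r :* a) :+ r :* o :* b)
             refl (r n) (1# - y) ψ _ _ ⟩
      (1# - y) * (r n * ψ) + (1# - y) * (r n * y ^ n) + r n * (1# - y) * y ^ suc n
        ≈⟨ +-congʳ (+-congʳ (trans (*-congˡ (shanks n)) (*-∑ (1# - y) _ n))) ⟩
      ∑ (λ s → (1# - y) * (r s * y ^ s)) (suc n) + r n * (1# - y) * y ^ suc n
        ≈⟨ telescope y n ⟨
      ∑ (λ s → r s * ((1# - x * y) * (y ^ s * x ^ (s ℕ.* 2)))) (suc n)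
        ≈⟨ ∑-cong (λ s → solve 3 (λ r e a → r :* (e :* a) := e :* (r :* a)) refl (r s) _ _) (suc n) ⟩
      ∑ (λ s → (1# - x * y) * (r s * (y ^ s * x ^ (s ℕ.* 2)))) (suc n)
        ≈⟨ *-∑ (1# - x * y) _ (suc n) ⟨
      (1# - x * y) * ∑ (λ s → r s * (y ^ s * x ^ (s ℕ.* 2))) (suc n)
        ≈⟨ *-congˡ (∑-cong (λ s → *-congˡ (x²y^ y s)) (suc n)) ⟨
      (1# - x * y) * ∑ (λ s → r s * (x * (x * y)) ^ s) (suc n) ∎)
      where
      y = x ^ suc (n ℕ.* 2)
      ψ = triSum x (n ℕ.* 2)
      t≈ : x ^ tri (n ℕ.* 2) ≈ y ^ n
      t≈ = trans (^-congʳ x (tri-double n)) (sym (^-assocʳ x (suc (n ℕ.* 2)) n))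
      t′≈ : x ^ tri (suc (n ℕ.* 2)) ≈ y ^ suc n
      t′≈ = trans (^-homo-* x (suc (n ℕ.* 2)) (tri (n ℕ.* 2))) (*-congˡ t≈)

  module Char2 (1+1≈0 : 1# + 1# ≈ 0#) where

    drop-double : ∀ u v → u + (1# + 1#) * v ≈ u
    drop-double u v = trans (+-congˡ (trans (*-congʳ 1+1≈0) (zeroˡ v))) (+-identityʳ u)

    -- Shanks' finite form of the pentagonal number theorem, with all signs dropped.
    module Pentagonal (x : Carrier) (r : ℕ → Carrier)
      (r-suc : ∀ n → r (suc n) * (1# - x ^ suc n) ≈ r n)
      (cancel : ∀ n {u v} → (1# - x ^ suc n) * u ≈ (1# - x ^ suc n) * v → u ≈ v)
      where

      x^tri-suc : ∀ m → x ^ tri (suc m) ≈ x ^ suc m * x ^ tri m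
      x^tri-suc m = ^-homo-* x (suc m) (tri m)

      -- The boundary terms cancel only up to sign: `r-suc` gives the factor 1 - x^s where the
      -- summand has x^s - 1. This is where characteristic 2 enters.
      telescope : ∀ y m →
        ∑ (λ s → r s * ((1# - x * y) * ((y ^ s * x ^ s) * x ^ tri s))) (suc m) ≈
        ∑ (λ s → r s * (y ^ s * x ^ tri s)) (suc m) - r m * (y ^ suc m * x ^ tri (suc m))
      telescope y zero = solve 3 (λ x y r →
        con (+ 0) :+ r :* ((con (+ 1) :- x :* y) :* ((con (+ 1) :* con (+ 1)) :* con (+ 1))) :=
        con (+ 0) :+ r :* (con (+ 1) :* con (+ 1)) :- r :* ((y :* con (+ 1)) :* (x :* con (+ 1))))
        refl x y (r 0)
      telescope y (suc m) = begin
        _ ≈⟨ +-congʳ (telescope y m) ⟩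
        _ ≈⟨ +-congʳ (+-congˡ (-‿cong (*-congʳ (r-suc m)))) ⟨
        _ ≈⟨ solve 7 (λ x y z Y t r S →
               S :- r :* (con (+ 1) :- x :* z) :* (y :* Y :* t)
                 :+ r :* ((con (+ 1) :- x :* y) :* ((y :* Y :* (x :* z)) :* t)) :=
               S :+ r :* (y :* Y :* t) :- r :* (y :* (y :* Y) :* (x :* (x :* z) :* t))
                 :+ con (+ 2) :* (r :* (y :* Y) :* t :* (x :* z :- con (+ 1))))
               refl x y (x ^ m) (y ^ m) (x ^ tri (suc m)) (r (suc m)) _ ⟩
        _ ≈⟨ drop-double _ _ ⟩
        _ ≈⟨ +-congˡ (-‿cong (*-congˡ (*-congˡ (x^tri-suc (suc m))))) ⟨
        _ ∎

      -- The sum stops in the middle of the n-th pair of pentagonal numbers, so that a step adds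
      -- `pent₂ n` and `pent₁ (suc n)`. The first is absorbed by the boundary term of `telescope`,
      -- the second becomes the top summand.
      shanks : ∀ n → r n * (pentSum x n + x ^ pent₁ n) ≈
                     ∑ (λ s → r s * ((x ^ n) ^ s * x ^ tri s)) (suc n)
      shanks zero    = solve 1 (λ r → r :* (con (+ 0) :+ con (+ 1)) :=
        con (+ 0) :+ r :* (con (+ 1) :* con (+ 1))) refl (r 0)
      shanks (suc n) = cancel n (begin
        e * (r (suc n) * (B + (x ^ pent₁ n + x ^ pent₂ n) + x ^ pent₁ (suc n)))
          ≈⟨ *-congˡ (*-congˡ (+-cong (+-congˡ (+-congˡ h≈)) g≈)) ⟩
        e * (r (suc n) * (B + (x ^ pent₁ n + y ^ suc n * t) + (x * y) ^ suc n * t))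
          ≈⟨ solve 6 (λ r e B p a b → e :* (r :* (B :+ (p :+ a) :+ b)) :=
               (r :* e) :* (B :+ p :+ a) :+ e :* (r :* b)) refl (r (suc n)) e B _ _ _ ⟩
        r (suc n) * e * (B + x ^ pent₁ n + y ^ suc n * t) + e * (r (suc n) * ((x * y) ^ suc n * t))
          ≈⟨ +-congʳ (*-congʳ (r-suc n)) ⟩
        r n * (B + x ^ pent₁ n + y ^ suc n * t) + e * (r (suc n) * ((x * y) ^ suc n * t))
          ≈⟨ +-congʳ (trans (distribˡ (r n) _ _) (+-congʳ (shanks n))) ⟩
        ∑ (λ s → r s * (y ^ s * x ^ tri s)) (suc n) + r n * (y ^ suc n * t)
          + e * (r (suc n) * ((x * y) ^ suc n * t))
          -- The sign is flipped to the one that `telescope` produces.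
          ≈⟨ +-congʳ (solve 2 (λ S a → S :+ a := S :- a :+ con (+ 2) :* a) refl _ _) ⟩
        _ + e * (r (suc n) * ((x * y) ^ suc n * t))
          ≈⟨ +-congʳ (drop-double _ _) ⟩
        _ + e * (r (suc n) * ((x * y) ^ suc n * t))
          ≈⟨ +-congʳ (telescope y n) ⟨
        ∑ (λ s → r s * (e * ((y ^ s * x ^ s) * x ^ tri s))) (suc n)
          + e * (r (suc n) * ((x * y) ^ suc n * t))
          ≈⟨ +-congʳ (∑-cong (λ s → solve 5 (λ r e Y z t → r :* (e :* ((Y :* z) :* t)) := e :* (r :* ((z :* Y) :* t)))
               refl (r s) e (y ^ s) (x ^ s) (x ^ tri s)) (suc n)) ⟩
        ∑ (λ s → e * (r s * ((x ^ s * y ^ s) * x ^ tri s))) (suc n)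
          + e * (r (suc n) * ((x * y) ^ suc n * t))
          ≈⟨ +-congʳ (∑-cong (λ s → *-congˡ (*-congˡ (*-congʳ (^-distrib-* x y s)))) (suc n)) ⟨
        ∑ (λ s → e * (r s * ((x * y) ^ s * x ^ tri s))) (suc (suc n))
          ≈⟨ *-∑ e _ (suc (suc n)) ⟨
        e * ∑ (λ s → r s * ((x * y) ^ s * x ^ tri s)) (suc (suc n)) ∎)
        where
        y = x ^ n
        e = 1# - x * y
        t = x ^ tri (suc n)
        B = pentSum x n
        h≈ : x ^ pent₂ n ≈ y ^ suc n * t
        h≈ = begin
          x ^ pent₂ n                     ≈⟨ ^-congʳ x (pent₂-tri n) ⟩
          x ^ (n ℕ.* suc n ℕ.+ tri (suc n)) ≈⟨ ^-homo-* x (n ℕ.* suc n) (tri (suc n)) ⟩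
          x ^ (n ℕ.* suc n) * t           ≈⟨ *-congʳ (^-assocʳ x n (suc n)) ⟨
          y ^ suc n * t                   ∎
        g≈ : x ^ pent₁ (suc n) ≈ (x * y) ^ suc n * t
        g≈ = begin
          x ^ pent₁ (suc n)                         ≈⟨ ^-congʳ x (pent₁-tri (suc n)) ⟩
          x ^ (suc n ℕ.* suc n ℕ.+ tri (suc n))       ≈⟨ ^-homo-* x (suc n ℕ.* suc n) (tri (suc n)) ⟩
          x ^ (suc n ℕ.* suc n) * t                 ≈⟨ *-congʳ (^-assocʳ x (suc n) (suc n)) ⟨
          (x * y) ^ suc n * t                       ∎

-- Formal power series

-- Depending only on the operations, and not on the equality of the coefficient ring,
-- these are the same functions on ℕ → ℤ for all moduli.
module RawSeries {A : Set} (_+_ _*_ : A → A → A) where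
  cons : A → (ℕ → A) → ℕ → A
  cons c f zero    = c
  cons c f (suc n) = f n

  tail : (ℕ → A) → ℕ → A
  tail f n = f (suc n)

  infixl 7 _⊛_
  _⊛_ : (ℕ → A) → (ℕ → A) → ℕ → A
  (f ⊛ g) zero    = f 0 * g 0
  (f ⊛ g) (suc n) = (f 0 * g (suc n)) + (tail f ⊛ g) n

module PowerSeriesRing (R : CommutativeRing 0ℓ 0ℓ) where
  open CommutativeRing R
  open Algebra.Properties.Ring ring using (-0#≈0#)
  open IntegerSolver R
  open Relation.Binary.Reasoning.Setoid setoid

  Series : Set
  Series = ℕ → Carrier

  infix 4 _≋_
  record _≋_ (f g : Series) : Set where
    constructor pointwise
    field at : ∀ n → f n ≈ g n
  open _≋_ public

  open RawSeries _+_ _*_ public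

  𝟘 𝟙 : Series
  𝟘 _ = 0#
  𝟙 = cons 1# 𝟘

  infixl 6 _⊕_
  infixr 7 _•_

  _⊕_ : Series → Series → Series
  (f ⊕ g) n = f n + g n

  ⊝_ : Series → Series
  (⊝ f) n = - f n

  _•_ : Carrier → Series → Series
  (c • f) n = c * f n

  -- The n-th coefficient of a product involves only coefficients of index at most n; this is what
  -- makes congruence modulo a power of `q` compatible with products.
  ⊛-cong-≤ : ∀ n {f f′ g g′} → (∀ m → m ≤ n → f m ≈ f′ m) → (∀ m → m ≤ n → g m ≈ g′ m) →
             (f ⊛ g) n ≈ (f′ ⊛ g′) n
  ⊛-cong-≤ zero    f≈ g≈ = *-cong (f≈ 0 z≤n) (g≈ 0 z≤n)
  ⊛-cong-≤ (suc n) f≈ g≈ = +-cong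
    (*-cong (f≈ 0 z≤n) (g≈ (suc n) ℕ.≤-refl))
    (⊛-cong-≤ n (λ m m≤n → f≈ (suc m) (s≤s m≤n)) (λ m m≤n → g≈ m (ℕ.m≤n⇒m≤1+n m≤n)))

  ⊛-cong : ∀ {f f′ g g′} → f ≋ f′ → g ≋ g′ → f ⊛ g ≋ f′ ⊛ g′
  ⊛-cong f≋ g≋ .at n = ⊛-cong-≤ n (λ m _ → f≋ .at m) (λ m _ → g≋ .at m)

  ⊛-zeroˡ : ∀ g n → (𝟘 ⊛ g) n ≈ 0#
  ⊛-zeroˡ g zero    = zeroˡ _
  ⊛-zeroˡ g (suc n) = trans (+-cong (zeroˡ _) (⊛-zeroˡ g n)) (+-identityˡ 0#)

  ⊛-distribʳ : ∀ h f g n → ((f ⊕ g) ⊛ h) n ≈ (f ⊛ h) n + (g ⊛ h) n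
  ⊛-distribʳ h f g zero    = distribʳ _ _ _
  ⊛-distribʳ h f g (suc n) = trans (+-congˡ (⊛-distribʳ h (tail f) (tail g) n))
    (solve 5 (λ a b c u v → (a :+ b) :* c :+ (u :+ v) := a :* c :+ u :+ (b :* c :+ v)) refl _ _ _ _ _)

  ⊛-•ˡ : ∀ c f g n → ((c • f) ⊛ g) n ≈ c * (f ⊛ g) n
  ⊛-•ˡ c f g zero    = *-assoc _ _ _
  ⊛-•ˡ c f g (suc n) = trans (+-congˡ (⊛-•ˡ c (tail f) g n))
    (solve 4 (λ c a b u → c :* a :* b :+ c :* u := c :* (a :* b :+ u)) refl _ _ _ _)

  -- The mirror image of the defining recursion, which peels off the left factor; commutativity
  -- follows by comparing the two.
  ⊛-sucʳ : ∀ f g n → (f ⊛ g) (suc n) ≈ (f ⊛ tail g) n + f (suc n) * g 0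
  ⊛-sucʳ f g zero    = refl
  ⊛-sucʳ f g (suc n) = trans (+-congˡ (⊛-sucʳ (tail f) g n)) (sym (+-assoc _ _ _))

  ⊛-comm : ∀ f g n → (f ⊛ g) n ≈ (g ⊛ f) n
  ⊛-comm f g zero    = *-comm _ _
  ⊛-comm f g (suc n) = begin
    f 0 * g (suc n) + (tail f ⊛ g) n  ≈⟨ +-cong (*-comm _ _) (⊛-comm (tail f) g n) ⟩
    g (suc n) * f 0 + (g ⊛ tail f) n  ≈⟨ +-comm _ _ ⟩
    (g ⊛ tail f) n + g (suc n) * f 0  ≈⟨ ⊛-sucʳ g f n ⟨
    (g ⊛ f) (suc n)                   ∎

  ⊛-assoc : ∀ f g h n → ((f ⊛ g) ⊛ h) n ≈ (f ⊛ (g ⊛ h)) n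
  ⊛-assoc f g h zero    = *-assoc _ _ _
  ⊛-assoc f g h (suc n) = begin
    f 0 * g 0 * h (suc n) + ((f 0 • tail g ⊕ tail f ⊛ g) ⊛ h) n
      ≈⟨ +-congˡ (⊛-distribʳ h (f 0 • tail g) (tail f ⊛ g) n) ⟩
    f 0 * g 0 * h (suc n) + (((f 0 • tail g) ⊛ h) n + ((tail f ⊛ g) ⊛ h) n)
      ≈⟨ +-congˡ (+-cong (⊛-•ˡ (f 0) (tail g) h n) (⊛-assoc (tail f) g h n)) ⟩
    f 0 * g 0 * h (suc n) + (f 0 * (tail g ⊛ h) n + (tail f ⊛ (g ⊛ h)) n)
      ≈⟨ solve 5 (λ a b c u v → a :* b :* c :+ (a :* u :+ v) := a :* (b :* c :+ u) :+ v) refl _ _ _ _ _ ⟩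
    f 0 * (g ⊛ h) (suc n) + (tail f ⊛ (g ⊛ h)) n ∎

  ⊛-identityˡ : ∀ f n → (𝟙 ⊛ f) n ≈ f n
  ⊛-identityˡ f zero    = *-identityˡ _
  ⊛-identityˡ f (suc n) = trans (+-cong (*-identityˡ _) (⊛-zeroˡ f n)) (+-identityʳ _)

  seriesRing : CommutativeRing 0ℓ 0ℓ
  seriesRing = record
    { Carrier = Series
    ; _≈_ = _≋_
    ; _+_ = _⊕_
    ; _*_ = _⊛_
    ; -_ = ⊝_
    ; 0# = 𝟘
    ; 1# = 𝟙
    ; isCommutativeRing = record
      { isRing = record
        { +-isAbelianGroup = record
          { isGroup = record
            { isMonoid = record
              { isSemigroup = record
                { isMagma = record
                  { isEquivalence = record
                    { refl  = pointwise λ _ → refl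
                    ; sym   = λ f≋g → pointwise λ n → sym (f≋g .at n)
                    ; trans = λ f≋g g≋h → pointwise λ n → trans (f≋g .at n) (g≋h .at n)
                    }
                  ; ∙-cong = λ f≋ g≋ → pointwise λ n → +-cong (f≋ .at n) (g≋ .at n)
                  }
                ; assoc = λ _ _ _ → pointwise λ _ → +-assoc _ _ _
                }
              ; identity = (λ _ → pointwise λ _ → +-identityˡ _)
                         , (λ _ → pointwise λ _ → +-identityʳ _)
              }
            ; inverse = (λ _ → pointwise λ _ → -‿inverseˡ _)
                      , (λ _ → pointwise λ _ → -‿inverseʳ _)
            ; ⁻¹-cong = λ f≋ → pointwise λ n → -‿cong (f≋ .at n)
            }
          ; comm = λ _ _ → pointwise λ _ → +-comm _ _
          }
        ; *-cong = ⊛-cong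
        ; *-assoc = λ f g h → pointwise (⊛-assoc f g h)
        ; *-identity = (λ f → pointwise (⊛-identityˡ f))
                     , (λ f → pointwise λ n → trans (⊛-comm f 𝟙 n) (⊛-identityˡ f n))
        ; distrib = (λ h f g → pointwise λ n → trans (⊛-comm h (f ⊕ g) n)
                      (trans (⊛-distribʳ h f g n) (+-cong (⊛-comm f h n) (⊛-comm g h n))))
                  , (λ h f g → pointwise (⊛-distribʳ h f g))
        }
      ; *-comm = λ f g → pointwise (⊛-comm f g)
      }
    }

module PowerSeries (R : CommutativeRing 0ℓ 0ℓ) where
  open PowerSeriesRing R public
    using (Series; pointwise; at; cons; tail; ⊛-cong-≤; ⊛-zeroˡ; ⊛-identityˡ; seriesRing)
  private module R where
    open CommutativeRing R public
    open Algebra.Properties.Ring ring public using (-0#≈0#)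
  open CommutativeRing seriesRing hiding (zero)
  open Algebra.Properties.Ring ring
  open Algebra.Properties.Semiring.Exp semiring
  open IntegerSolver seriesRing
  open FiniteIdentities seriesRing
  open Relation.Binary.Reasoning.Setoid setoid

  -- Congruence modulo powers of q, and limits

  infix 4 _≈[_]_
  record _≈[_]_ (f : Series) (k : ℕ) (g : Series) : Set where
    constructor below
    field at< : ∀ n → n < k → f n R.≈ g n
  open _≈[_]_ public

  ≈⇒≈[] : ∀ {f g k} → f ≈ g → f ≈[ k ] g
  ≈⇒≈[] f≈g .at< n _ = f≈g .at n

  ≈[]⇒≈ : ∀ {f g} → (∀ k → f ≈[ k ] g) → f ≈ g
  ≈[]⇒≈ f≈g .at n = f≈g (suc n) .at< n ℕ.≤-refl

  ≈[]-refl : ∀ {f k} → f ≈[ k ] f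
  ≈[]-refl = ≈⇒≈[] refl

  ≈[]-sym : ∀ {f g k} → f ≈[ k ] g → g ≈[ k ] f
  ≈[]-sym f≈g .at< n n<k = R.sym (f≈g .at< n n<k)

  ≈[]-trans : ∀ {f g h k} → f ≈[ k ] g → g ≈[ k ] h → f ≈[ k ] h
  ≈[]-trans f≈g g≈h .at< n n<k = R.trans (f≈g .at< n n<k) (g≈h .at< n n<k)

  ≈[]-mono : ∀ {f g k l} → k ≤ l → f ≈[ l ] g → f ≈[ k ] g
  ≈[]-mono k≤l f≈g .at< n n<k = f≈g .at< n (ℕ.≤-trans n<k k≤l)

  +-cong[] : ∀ {f f′ g g′ k} → f ≈[ k ] f′ → g ≈[ k ] g′ → f + g ≈[ k ] f′ + g′
  +-cong[] f≈ g≈ .at< n n<k = R.+-cong (f≈ .at< n n<k) (g≈ .at< n n<k)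

  +-identityʳ[] : ∀ {f g k} → g ≈[ k ] 0# → f + g ≈[ k ] f
  +-identityʳ[] g≈0 = ≈[]-trans (+-cong[] ≈[]-refl g≈0) (≈⇒≈[] (+-identityʳ _))

  *-cong[] : ∀ {f f′ g g′ k} → f ≈[ k ] f′ → g ≈[ k ] g′ → f * g ≈[ k ] f′ * g′
  *-cong[] f≈ g≈ .at< n n<k = ⊛-cong-≤ n
    (λ m m≤n → f≈ .at< m (ℕ.≤-<-trans m≤n n<k)) (λ m m≤n → g≈ .at< m (ℕ.≤-<-trans m≤n n<k))

  *-zeroʳ[] : ∀ f {g k} → g ≈[ k ] 0# → f * g ≈[ k ] 0#
  *-zeroʳ[] f g≈0 = ≈[]-trans (*-cong[] ≈[]-refl g≈0) (≈⇒≈[] (zeroʳ f))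

  -- A factor without constant term raises the order by one.
  *-suc[] : ∀ {f g k} → f 0 R.≈ R.0# → g ≈[ k ] 0# → f * g ≈[ suc k ] 0#
  *-suc[] f0≈0 g≈0 .at< zero    _         = R.trans (R.*-congʳ f0≈0) (R.zeroˡ _)
  *-suc[] {f} f0≈0 g≈0 .at< (suc n) (s≤s n<k) = R.trans
    (R.+-cong (R.trans (R.*-congʳ f0≈0) (R.zeroˡ _)) (*-zeroʳ[] (tail f) g≈0 .at< n n<k))
    (R.+-identityˡ R.0#)

  ^≈[]0 : ∀ {f} → f 0 R.≈ R.0# → ∀ k → f ^ k ≈[ k ] 0#
  ^≈[]0 f0≈0 zero    .at< _ ()
  ^≈[]0 f0≈0 (suc k) = *-suc[] f0≈0 (^≈[]0 f0≈0 k)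

  ^suc-head : ∀ {f} → f 0 R.≈ R.0# → ∀ k → (f ^ suc k) 0 R.≈ R.0#
  ^suc-head f0≈0 k = R.trans (R.*-congʳ f0≈0) (R.zeroˡ _)

  -- If `s k` is final below index k, then `s (suc n)` is the first member whose n-th coefficient is
  -- final.
  lim : (ℕ → Series) → Series
  lim s n = s (suc n) n

  lim-≈[] : ∀ s → (∀ k → s (suc k) ≈[ k ] s k) → ∀ k → s k ≈[ k ] lim s
  lim-≈[] s stable k .at< n n<k with d , ≡.refl ← ℕ.m≤n⇒∃[o]m+o≡n n<k = go d
    where
    go : ∀ d → s (suc n ℕ.+ d) n R.≈ s (suc n) n
    go zero    rewrite ℕ.+-identityʳ n = R.refl
    go (suc d) rewrite ℕ.+-suc n d =
      R.trans (stable (suc (n ℕ.+ d)) .at< n (s≤s (ℕ.m≤m+n n d))) (go d)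

  partialSums-≈[] : ∀ {f} → (∀ k → f k ≈[ k ] 0#) → ∀ k → ∑ f k ≈[ k ] lim (∑ f)
  partialSums-≈[] {f} f→0 = lim-≈[] (∑ f) λ k → +-identityʳ[] (f→0 k)

  ∑-≈[]-head : ∀ {f k} → (∀ s → f (suc s) ≈[ k ] 0#) → ∀ n → ∑ f (suc n) ≈[ k ] f 0
  ∑-≈[]-head f≈0 zero    = ≈⇒≈[] (+-identityˡ _)
  ∑-≈[]-head f≈0 (suc m) = ≈[]-trans (+-identityʳ[] (f≈0 m)) (∑-≈[]-head f≈0 m)

  module Geometric (f : Series) (f0≈0 : f 0 R.≈ R.0#) where
    geometric : Series
    geometric = lim (∑ (f ^_))

    geometric-finite : ∀ k → (1# - f) * ∑ (f ^_) k ≈ 1# - f ^ k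
    geometric-finite zero    = solve 1 (λ f → (con (+ 1) :- f) :* con (+ 0) := con (+ 1) :- con (+ 1)) refl f
    geometric-finite (suc k) = trans (distribˡ (1# - f) _ _) (trans (+-congʳ (geometric-finite k))
      (solve 2 (λ f g → con (+ 1) :- g :+ (con (+ 1) :- f) :* g := con (+ 1) :- f :* g) refl f (f ^ k)))

    geometric-inverse : (1# - f) * geometric ≈ 1#
    geometric-inverse = ≈[]⇒≈ λ k →
      ≈[]-trans (*-cong[] ≈[]-refl (≈[]-sym (partialSums-≈[] (^≈[]0 f0≈0) k)))
      (≈[]-trans (≈⇒≈[] (geometric-finite k))
      (+-identityʳ[] (below λ n n<k → R.trans (R.-‿cong (^≈[]0 f0≈0 k .at< n n<k)) R.-0#≈0#)))

    1-f-cancel : ∀ {u v} → (1# - f) * u ≈ (1# - f) * v → u ≈ v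
    1-f-cancel {u} {v} eq = begin
      u                               ≈⟨ *-identityˡ u ⟨
      1# * u                          ≈⟨ *-congʳ geometric-inverse ⟨
      (1# - f) * geometric * u        ≈⟨ swap u ⟩
      geometric * ((1# - f) * u)      ≈⟨ *-congˡ eq ⟩
      geometric * ((1# - f) * v)      ≈⟨ swap v ⟨
      (1# - f) * geometric * v        ≈⟨ *-congʳ geometric-inverse ⟩
      1# * v                          ≈⟨ *-identityˡ v ⟩
      v                               ∎
      where
      swap : ∀ w → (1# - f) * geometric * w ≈ geometric * ((1# - f) * w)
      swap w = solve 3 (λ e g w → e :* g :* w := g :* (e :* w)) refl (1# - f) geometric w

  q : Series
  q = cons R.0# 1#

  q* : ∀ f → q * f ≈ cons R.0# f
  q* f .at zero    = R.zeroˡ _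
  q* f .at (suc n) = R.trans (R.+-cong (R.zeroˡ _) (⊛-identityˡ f n)) (R.+-identityˡ _)

  q^*-< : ∀ k f n → n < k → (q ^ k * f) n R.≈ R.0#
  q^*-< k f = ≈[]-trans (≈⇒≈[] (*-comm (q ^ k) f)) (*-zeroʳ[] f (^≈[]0 R.refl k)) .at<

  q^*-+ : ∀ k f n → (q ^ k * f) (k ℕ.+ n) R.≈ f n
  q^*-+ zero    f n = ⊛-identityˡ f n
  q^*-+ (suc k) f n = R.trans (*-assoc q (q ^ k) f .at (suc k ℕ.+ n))
    (R.trans (q* (q ^ k * f) .at (suc k ℕ.+ n)) (q^*-+ k f n))

  shift-recurrence : ∀ k {f g h} → (∀ n → n < k → f n R.≈ g n) →
                     (∀ n → f (k ℕ.+ n) R.≈ g (k ℕ.+ n) R.+ h n) → f ≈ g + q ^ k * h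
  shift-recurrence k {f} {g} {h} below-k above-k .at n with n ℕ.<? k
  ... | yes n<k = R.trans (below-k n n<k)
    (R.sym (R.trans (R.+-congˡ (q^*-< k h n n<k)) (R.+-identityʳ _)))
  ... | no n≮k with d , ≡.refl ← ℕ.m≤n⇒∃[o]m+o≡n (ℕ.≮⇒≥ n≮k) =
    R.trans (above-k d) (R.+-congˡ (R.sym (q^*-+ k h d)))

  -- Sections modulo 3 and the substitution of q³ for q

  U : ℕ → Series → Series
  U i f n = f (i ℕ.+ n ℕ.* 3)

  U-cong : ∀ i {f g} → f ≈ g → U i f ≈ U i g
  U-cong i f≈g .at n = f≈g .at _

  U-ext : ∀ {f g} → U 0 f ≈ U 0 g → U 1 f ≈ U 1 g → U 2 f ≈ U 2 g → f ≈ g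
  U-ext {f} {g} e₀ e₁ e₂ = pointwise (go f g (e₀ .at) (e₁ .at) (e₂ .at))
    where
    go : ∀ f g → (∀ n → f (n ℕ.* 3) R.≈ g (n ℕ.* 3)) →
         (∀ n → f (1 ℕ.+ n ℕ.* 3) R.≈ g (1 ℕ.+ n ℕ.* 3)) →
         (∀ n → f (2 ℕ.+ n ℕ.* 3) R.≈ g (2 ℕ.+ n ℕ.* 3)) → ∀ n → f n R.≈ g n
    go f g e₀ e₁ e₂ 0 = e₀ 0
    go f g e₀ e₁ e₂ 1 = e₁ 0
    go f g e₀ e₁ e₂ 2 = e₂ 0
    go f g e₀ e₁ e₂ (suc (suc (suc n))) = go (λ k → f (3 ℕ.+ k)) (λ k → g (3 ℕ.+ k))
      (λ k → e₀ (suc k)) (λ k → e₁ (suc k)) (λ k → e₂ (suc k)) n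

  -- σ f is f(q³).
  σ : Series → Series
  σ f 0 = f 0
  σ f 1 = R.0#
  σ f 2 = R.0#
  σ f (suc (suc (suc n))) = σ (tail f) n

  σ-cong[] : ∀ {f g k} → f ≈[ k ] g → σ f ≈[ k ] σ g
  σ-cong[] {k = k} f≈g .at< = go k (f≈g .at<)
    where
    go : ∀ k {f g} → (∀ n → n < k → f n R.≈ g n) → ∀ n → n < k → σ f n R.≈ σ g n
    go k f≈g 0 0<k = f≈g 0 0<k
    go k f≈g 1 _   = R.refl
    go k f≈g 2 _   = R.refl
    go (suc (suc (suc k))) f≈g (suc (suc (suc n))) (s≤s (s≤s (s≤s n<k))) =
      go k (λ m m<k → f≈g (suc m) (s≤s (ℕ.<-trans m<k (ℕ.m<n⇒m<1+n ℕ.≤-refl)))) n n<k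

  σ-cong : ∀ {f g} → f ≈ g → σ f ≈ σ g
  σ-cong f≈g = ≈[]⇒≈ λ k → σ-cong[] (≈⇒≈[] f≈g)

  σ-+ : ∀ f g → σ (f + g) ≈ σ f + σ g
  σ-+ f g .at n = go f g n
    where
    go : ∀ f g n → σ (f + g) n R.≈ σ f n R.+ σ g n
    go f g 0 = R.refl
    go f g 1 = R.sym (R.+-identityˡ _)
    go f g 2 = R.sym (R.+-identityˡ _)
    go f g (suc (suc (suc n))) = go (tail f) (tail g) n

  σ-neg : ∀ f → σ (- f) ≈ - σ f
  σ-neg f .at n = go f n
    where
    go : ∀ f n → σ (- f) n R.≈ R.- σ f n
    go f 0 = R.refl
    go f 1 = R.sym R.-0#≈0#
    go f 2 = R.sym R.-0#≈0#
    go f (suc (suc (suc n))) = go (tail f) n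

  σ-0 : σ 0# ≈ 0#
  σ-0 .at = go
    where
    go : ∀ n → σ 0# n R.≈ R.0#
    go 0 = R.refl
    go 1 = R.refl
    go 2 = R.refl
    go (suc (suc (suc n))) = go n

  σ-1 : σ 1# ≈ 1#
  σ-1 .at 0 = R.refl
  σ-1 .at 1 = R.refl
  σ-1 .at 2 = R.refl
  σ-1 .at (suc (suc (suc n))) = σ-0 .at n

  U₀-σ : ∀ f → U 0 (σ f) ≈ f
  U₀-σ f .at n = go f n
    where
    go : ∀ f n → σ f (n ℕ.* 3) R.≈ f n
    go f zero    = R.refl
    go f (suc n) = go (tail f) n

  U₁-σ : ∀ f → U 1 (σ f) ≈ 0#
  U₁-σ f .at n = go f n
    where
    go : ∀ f n → σ f (1 ℕ.+ n ℕ.* 3) R.≈ R.0#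
    go f zero    = R.refl
    go f (suc n) = go (tail f) n

  U₂-σ : ∀ f → U 2 (σ f) ≈ 0#
  U₂-σ f .at n = go f n
    where
    go : ∀ f n → σ f (2 ℕ.+ n ℕ.* 3) R.≈ R.0#
    go f zero    = R.refl
    go f (suc n) = go (tail f) n

  σ*-+3 : ∀ g f n → (σ g * f) (3 ℕ.+ n) R.≈ g 0 R.* f (3 ℕ.+ n) R.+ (σ (tail g) * f) n
  σ*-+3 g f n = R.+-congˡ (R.trans (R.+-cong (R.zeroˡ _) (R.trans (R.+-congʳ (R.zeroˡ _)) (R.+-identityˡ _)))
    (R.+-identityˡ _))

  σ*-<3 : ∀ g f i → i < 3 → (σ g * f) i R.≈ g 0 R.* f i
  σ*-<3 g f 0 _ = R.refl
  σ*-<3 g f 1 _ = R.trans (R.+-congˡ (R.zeroˡ _)) (R.+-identityʳ _)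
  σ*-<3 g f 2 _ = R.trans (R.+-congˡ (R.trans (R.+-cong (R.zeroˡ _) (R.zeroˡ _)) (R.+-identityʳ _))) (R.+-identityʳ _)
  σ*-<3 g f (suc (suc (suc i))) (s≤s (s≤s (s≤s ())))

  -- Multiplying by a series in q³ does not mix the residue classes of exponents, so such a factor
  -- can be pulled out of a section.
  U-σ* : ∀ i → i < 3 → ∀ g f → U i (σ g * f) ≈ g * U i f
  U-σ* i i<3 g f .at n = go g n
    where
    +3 : ∀ n → i ℕ.+ suc n ℕ.* 3 ≡ 3 ℕ.+ (i ℕ.+ n ℕ.* 3)
    +3 n = ≡.trans (≡.sym (ℕ.+-assoc i 3 _)) (≡.trans (≡.cong (ℕ._+ n ℕ.* 3) (ℕ.+-comm i 3)) (ℕ.+-assoc 3 i _))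
    go : ∀ g n → U i (σ g * f) n R.≈ (g * U i f) n
    go g zero    rewrite ℕ.+-identityʳ i = σ*-<3 g f i i<3
    go g (suc n) rewrite +3 n = R.trans (σ*-+3 g f _) (R.+-congˡ (go (tail g) n))

  U₀-q* : ∀ f → U 0 (q * f) ≈ q * U 2 f
  U₀-q* f .at zero    = R.trans (R.zeroˡ _) (R.sym (R.zeroˡ _))
  U₀-q* f .at (suc n) = R.trans (q* f .at _) (R.sym (q* (U 2 f) .at (suc n)))

  U₁-q* : ∀ f → U 1 (q * f) ≈ U 0 f
  U₁-q* f .at n = q* f .at _

  U₂-q* : ∀ f → U 2 (q * f) ≈ U 1 f
  U₂-q* f .at n = q* f .at _

  -- Both sides live on exponents divisible by 3, so comparing sections reduces the claim to `U-σ*`.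
  σ-* : ∀ f g → σ (f * g) ≈ σ f * σ g
  σ-* f g = U-ext
    (trans (U₀-σ (f * g)) (sym (trans (U-σ* 0 (s≤s z≤n) f (σ g)) (*-congˡ (U₀-σ g)))))
    (trans (U₁-σ (f * g)) (sym (trans (U-σ* 1 (s≤s (s≤s z≤n)) f (σ g)) (trans (*-congˡ (U₁-σ g)) (zeroʳ f)))))
    (trans (U₂-σ (f * g)) (sym (trans (U-σ* 2 (s≤s (s≤s (s≤s z≤n))) f (σ g)) (trans (*-congˡ (U₂-σ g)) (zeroʳ f)))))

  σ-^ : ∀ f n → σ (f ^ n) ≈ σ f ^ n
  σ-^ f zero    = σ-1
  σ-^ f (suc n) = trans (σ-* f (f ^ n)) (*-congˡ (σ-^ f n))

  σ-q : σ q ≈ q * (q * q)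
  σ-q = sym (trans (q* (q * q)) (pointwise λ
    { 0 → R.refl
    ; 1 → R.zeroˡ _
    ; 2 → q* q .at 1
    ; (suc (suc (suc n))) → R.trans (q* q .at (2 ℕ.+ n)) (R.sym (σ-1 .at n)) }))

  dissection : ∀ f → f ≈ σ (U 0 f) + q * σ (U 1 f) + q * (q * σ (U 2 f))
  dissection f = U-ext
    (sym (begin
      U 0 s₀ + U 0 (q * s₁) + U 0 (q * (q * s₂))
        ≈⟨ +-cong (+-cong (U₀-σ (U 0 f)) (trans (U₀-q* s₁) (*-congˡ (U₂-σ (U 1 f)))))
                  (trans (U₀-q* (q * s₂)) (*-congˡ (trans (U₂-q* s₂) (U₁-σ (U 2 f))))) ⟩
      U 0 f + q * 0# + q * 0#
        ≈⟨ solve 2 (λ a q → a :+ q :* con (+ 0) :+ q :* con (+ 0) := a) refl (U 0 f) q ⟩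
      U 0 f ∎))
    (sym (begin
      U 1 s₀ + U 1 (q * s₁) + U 1 (q * (q * s₂))
        ≈⟨ +-cong (+-cong (U₁-σ (U 0 f)) (trans (U₁-q* s₁) (U₀-σ (U 1 f))))
                  (trans (U₁-q* (q * s₂)) (trans (U₀-q* s₂) (*-congˡ (U₂-σ (U 2 f))))) ⟩
      0# + U 1 f + q * 0#
        ≈⟨ solve 2 (λ a q → con (+ 0) :+ a :+ q :* con (+ 0) := a) refl (U 1 f) q ⟩
      U 1 f ∎))
    (sym (begin
      U 2 s₀ + U 2 (q * s₁) + U 2 (q * (q * s₂))
        ≈⟨ +-cong (+-cong (U₂-σ (U 0 f)) (trans (U₂-q* s₁) (U₁-σ (U 1 f))))
                  (trans (U₂-q* (q * s₂)) (trans (U₁-q* s₂) (U₀-σ (U 2 f)))) ⟩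
      0# + 0# + U 2 f
        ≈⟨ solve 1 (λ a → con (+ 0) :+ con (+ 0) :+ a := a) refl (U 2 f) ⟩
      U 2 f ∎))
    where
    s₀ = σ (U 0 f)
    s₁ = σ (U 1 f)
    s₂ = σ (U 2 f)

  U-* : ∀ i → i < 3 → ∀ f g →
    U i (f * g) ≈ U 0 f * U i g + U 1 f * U i (q * g) + U 2 f * U i (q * (q * g))
  U-* i i<3 f g = begin
    U i (f * g) ≈⟨ U-cong i (*-congʳ (dissection f)) ⟩
    U i ((s₀ + q * s₁ + q * (q * s₂)) * g)
      ≈⟨ U-cong i (solve 5 (λ a b c q g → (a :+ q :* b :+ q :* (q :* c)) :* g :=
           a :* g :+ b :* (q :* g) :+ c :* (q :* (q :* g))) refl s₀ s₁ s₂ q g) ⟩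
    U i (s₀ * g) + U i (s₁ * (q * g)) + U i (s₂ * (q * (q * g)))
      ≈⟨ +-cong (+-cong (U-σ* i i<3 (U 0 f) g) (U-σ* i i<3 (U 1 f) (q * g))) (U-σ* i i<3 (U 2 f) (q * (q * g))) ⟩
    U 0 f * U i g + U 1 f * U i (q * g) + U 2 f * U i (q * (q * g)) ∎
    where
    s₀ = σ (U 0 f)
    s₁ = σ (U 1 f)
    s₂ = σ (U 2 f)

  U₀-* : ∀ f g → U 0 (f * g) ≈ U 0 f * U 0 g + U 1 f * (q * U 2 g) + U 2 f * (q * U 1 g)
  U₀-* f g = trans (U-* 0 (s≤s z≤n) f g)
    (+-cong (+-congˡ (*-congˡ (U₀-q* g))) (*-congˡ (trans (U₀-q* (q * g)) (*-congˡ (U₂-q* g)))))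

  U₁-* : ∀ f g → U 1 (f * g) ≈ U 0 f * U 1 g + U 1 f * U 0 g + U 2 f * (q * U 2 g)
  U₁-* f g = trans (U-* 1 (s≤s (s≤s z≤n)) f g)
    (+-cong (+-congˡ (*-congˡ (U₁-q* g))) (*-congˡ (trans (U₁-q* (q * g)) (U₀-q* g))))

  U₂-* : ∀ f g → U 2 (f * g) ≈ U 0 f * U 2 g + U 1 f * U 1 g + U 2 f * U 0 g
  U₂-* f g = trans (U-* 2 (s≤s (s≤s (s≤s z≤n))) f g)
    (+-cong (+-congˡ (*-congˡ (U₂-q* g))) (*-congˡ (trans (U₂-q* (q * g)) (U₁-q* g))))

  -- The Frobenius map in characteristic 3

  module _ (1+1+1≈0 : R.1# R.+ R.1# R.+ R.1# R.≈ R.0#) (c³≈c : ∀ c → c R.* c R.* c R.≈ c) where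

    triple : 1# + 1# + 1# ≈ 0#
    triple .at zero    = 1+1+1≈0
    triple .at (suc n) = R.trans (R.+-identityʳ _) (R.+-identityʳ _)

    -- For f = c + qt the mixed terms of the cube are multiples of 3. What is left is a constant and
    -- q³ times the cube of the tail, which matches the three-step recursion of `σ`; Fermat's `c³≈c`
    -- handles the constant.
    cube-splits : ∀ f → f * f * f ≈ cons (f 0 R.* f 0 R.* f 0) 0# + q * (q * (q * (tail f * tail f * tail f)))
    cube-splits f = begin
      f * f * f ≈⟨ *-cong (*-cong f≈ f≈) f≈ ⟩
      (c + q * t) * (c + q * t) * (c + q * t)
        ≈⟨ solve 3 (λ c q t → (c :+ q :* t) :* (c :+ q :* t) :* (c :+ q :* t) :=
             c :* c :* c :+ q :* (q :* (q :* (t :* t :* t)))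
             :+ con (+ 3) :* (c :* c :* q :* t :+ c :* q :* q :* t :* t)) refl c q t ⟩
      c * c * c + q * (q * (q * (t * t * t))) + (1# + 1# + 1#) * _
        ≈⟨ trans (+-congˡ (trans (*-congʳ triple) (zeroˡ _))) (+-identityʳ _) ⟩
      c * c * c + q * (q * (q * (t * t * t)))
        ≈⟨ +-congʳ (trans (*-congʳ (const-* (f 0) (f 0))) (const-* (f 0 R.* f 0) (f 0))) ⟩
      cons (f 0 R.* f 0 R.* f 0) 0# + q * (q * (q * (t * t * t))) ∎
      where
      c = cons (f 0) 0#
      t = tail f
      f≈ : f ≈ c + q * t
      f≈ .at zero    = R.sym (R.trans (R.+-congˡ (R.zeroˡ _)) (R.+-identityʳ _))
      f≈ .at (suc n) = R.sym (R.trans (R.+-identityˡ _) (q* t .at (suc n)))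
      const-* : ∀ a b → cons a 0# * cons b 0# ≈ cons (a R.* b) 0#
      const-* a b .at zero    = R.refl
      const-* a b .at (suc n) = R.trans (R.+-cong (R.zeroʳ a) (⊛-zeroˡ _ n)) (R.+-identityˡ _)

    frobenius : ∀ f → f * f * f ≈ σ f
    frobenius f .at n = go f n
      where
      q³* : ∀ g → q * (q * (q * g)) ≈ cons R.0# (cons R.0# (cons R.0# g))
      q³* g = trans (q* _) (pointwise λ
        { zero → R.refl
        ; (suc n) → R.trans (q* _ .at n) (cong-cons n) })
        where
        cong-cons : ∀ n → cons R.0# (q * g) n R.≈ cons R.0# (cons R.0# g) n
        cong-cons zero    = R.refl
        cong-cons (suc n) = q* g .at n
      split : ∀ f n → (f * f * f) n R.≈ cons (f 0 R.* f 0 R.* f 0) 0# n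
                R.+ cons R.0# (cons R.0# (cons R.0# (tail f * tail f * tail f))) n
      split f n = R.trans (cube-splits f .at n) (R.+-congˡ (q³* (tail f * tail f * tail f) .at n))
      go : ∀ f n → (f * f * f) n R.≈ σ f n
      go f 0 = c³≈c (f 0)
      go f 1 = R.trans (split f 1) (R.+-identityˡ _)
      go f 2 = R.trans (split f 2) (R.+-identityˡ _)
      go f (suc (suc (suc n))) = R.trans (split f (3 ℕ.+ n)) (R.trans (R.+-identityˡ _) (go (tail f) n))

-- The theta functions ψ and α

n≤tri : ∀ n → n ≤ tri n
n≤tri zero    = z≤n
n≤tri (suc n) = ℕ.m≤m+n (suc n) (tri n)

n≤pent₁ : ∀ n → n ≤ pent₁ n
n≤pent₁ zero    = z≤n
n≤pent₁ (suc n) = ℕ.m≤m+n (suc n) (pent₂ n)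

n≤pent₂ : ∀ n → n ≤ pent₂ n
n≤pent₂ n = ℕ.≤-trans (n≤pent₁ n) (ℕ.m≤n+m (pent₁ n) (suc (n ℕ.* 2)))

module _ where
  open Data.Nat.Solver.+-*-Solver

  -- This and the next two lemmas are the sorting by residue of the index: indices 0 and 2 modulo 3
  -- give three times a generalised pentagonal number, index 1 gives one more than nine times a
  -- triangular number.
  tri-*3 : ∀ k → tri (k ℕ.* 3) ≡ pent₁ k ℕ.* 3
  tri-*3 zero    = ≡.refl
  tri-*3 (suc k) = ≡.trans
    (≡.cong (λ t → (3 ℕ.+ k ℕ.* 3) ℕ.+ ((2 ℕ.+ k ℕ.* 3) ℕ.+ ((1 ℕ.+ k ℕ.* 3) ℕ.+ t))) (tri-*3 k))
    (solve 2 (λ k p → (con 3 :+ k :* con 3) :+ ((con 2 :+ k :* con 3) :+ ((con 1 :+ k :* con 3) :+ p :* con 3))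
                   := ((con 1 :+ k) :+ ((con 1 :+ k :* con 2) :+ p)) :* con 3) ≡.refl k (pent₁ k))

  tri-2+*3 : ∀ k → tri (2 ℕ.+ k ℕ.* 3) ≡ pent₂ k ℕ.* 3
  tri-2+*3 k = ≡.trans
    (≡.cong (λ t → (2 ℕ.+ k ℕ.* 3) ℕ.+ ((1 ℕ.+ k ℕ.* 3) ℕ.+ t)) (tri-*3 k))
    (solve 2 (λ k p → (con 2 :+ k :* con 3) :+ ((con 1 :+ k :* con 3) :+ p :* con 3)
                   := ((con 1 :+ k :* con 2) :+ p) :* con 3) ≡.refl k (pent₁ k))

  tri-1+*3 : ∀ k → tri (1 ℕ.+ k ℕ.* 3) ≡ suc (tri k ℕ.* 9)
  tri-1+*3 zero    = ≡.refl
  tri-1+*3 (suc k) = ≡.trans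
    (≡.cong (λ t → (4 ℕ.+ k ℕ.* 3) ℕ.+ ((3 ℕ.+ k ℕ.* 3) ℕ.+ ((2 ℕ.+ k ℕ.* 3) ℕ.+ t))) (tri-1+*3 k))
    (solve 2 (λ k p → (con 4 :+ k :* con 3) :+ ((con 3 :+ k :* con 3) :+ ((con 2 :+ k :* con 3) :+ (con 1 :+ p :* con 9)))
                   := con 1 :+ ((con 1 :+ k) :+ p) :* con 9) ≡.refl k (tri k))

module Theta (R : CommutativeRing 0ℓ 0ℓ) where
  open PowerSeries R
  private module R = CommutativeRing R
  open CommutativeRing seriesRing hiding (zero)
  open Algebra.Properties.Ring ring
  open Algebra.Properties.Semiring.Exp semiring
  open IntegerSolver seriesRing
  open FiniteIdentities seriesRing
  open Relation.Binary.Reasoning.Setoid setoid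

  x : Series
  x = - q

  x-head : x 0 R.≈ R.0#
  x-head = Algebra.Properties.Ring.-0#≈0# R.ring

  x^≈[]0 : ∀ {k n} → k ≤ n → x ^ n ≈[ k ] 0#
  x^≈[]0 k≤n = ≈[]-mono k≤n (^≈[]0 x-head _)

  -- ψ is ψ(-q), and α is the theta function with ψ(-q) = α(q³) - q ψ(-q⁹).
  ψ α : Series
  ψ = lim (triSum x)
  α = lim (pentSum x)

  ψ-≈[] : ∀ k → triSum x k ≈[ k ] ψ
  ψ-≈[] = partialSums-≈[] λ k → x^≈[]0 (n≤tri k)

  α-≈[] : ∀ k → pentSum x k ≈[ k ] α
  α-≈[] = partialSums-≈[] λ k →
    ≈[]-trans (+-identityʳ[] (x^≈[]0 (n≤pent₂ k))) (x^≈[]0 (n≤pent₁ k))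

  -- Cubing is odd, so x³ = -q³ is again `x` with q³ in place of q; the signs of the theta series
  -- survive the substitution.
  x^*3 : ∀ k → x ^ (k ℕ.* 3) ≈ σ (x ^ k)
  x^*3 k = begin
    x ^ (k ℕ.* 3)   ≡⟨ ≡.cong (x ^_) (ℕ.*-comm k 3) ⟩
    x ^ (3 ℕ.* k)   ≈⟨ ^-assocʳ x 3 k ⟨
    (x ^ 3) ^ k     ≈⟨ ^-congˡ k x³ ⟩
    σ x ^ k         ≈⟨ σ-^ x k ⟨
    σ (x ^ k)       ∎
    where
    x³ : x ^ 3 ≈ σ x
    x³ = trans (solve 1 (λ q → (:- q) :* ((:- q) :* ((:- q) :* con (+ 1))) := :- (q :* (q :* q))) refl q)
      (sym (trans (σ-neg q) (-‿cong σ-q)))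

  triSum-dissection : ∀ n → triSum x (n ℕ.* 3) ≈ σ (pentSum x n) + x * σ (σ (triSum x n))
  triSum-dissection zero = sym (begin
    σ 0# + x * σ (σ 0#)  ≈⟨ +-cong σ-0 (*-congˡ (trans (σ-cong σ-0) σ-0)) ⟩
    0# + x * 0#          ≈⟨ solve 1 (λ x → con (+ 0) :+ x :* con (+ 0) := con (+ 0)) refl x ⟩
    0#                   ∎)
  triSum-dissection (suc n) = begin
    triSum x (n ℕ.* 3) + x ^ tri (n ℕ.* 3) + x ^ tri (1 ℕ.+ n ℕ.* 3) + x ^ tri (2 ℕ.+ n ℕ.* 3)
      ≈⟨ +-cong (+-cong (+-cong (triSum-dissection n)
           (trans (^-congʳ x (tri-*3 n)) (x^*3 (pent₁ n))))
           (trans (^-congʳ x (tri-1+*3 n)) (*-congˡ x^*9)))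
           (trans (^-congʳ x (tri-2+*3 n)) (x^*3 (pent₂ n))) ⟩
    σ (pentSum x n) + x * σ (σ (triSum x n)) + σ (x ^ pent₁ n) + x * σ (σ (x ^ tri n)) + σ (x ^ pent₂ n)
      ≈⟨ solve 6 (λ x a b c d e → a :+ x :* b :+ c :+ x :* d :+ e := a :+ (c :+ e) :+ x :* (b :+ d))
           refl x _ _ _ _ _ ⟩
    σ (pentSum x n) + (σ (x ^ pent₁ n) + σ (x ^ pent₂ n)) + x * (σ (σ (triSum x n)) + σ (σ (x ^ tri n)))
      ≈⟨ +-cong (+-congˡ (σ-+ _ _)) (*-congˡ (trans (σ-cong (σ-+ _ _)) (σ-+ _ _))) ⟨
    σ (pentSum x n) + σ (x ^ pent₁ n + x ^ pent₂ n) + x * σ (σ (triSum x (suc n)))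
      ≈⟨ +-congʳ (σ-+ _ _) ⟨
    σ (pentSum x (suc n)) + x * σ (σ (triSum x (suc n))) ∎
    where
    x^*9 : x ^ (tri n ℕ.* 9) ≈ σ (σ (x ^ tri n))
    x^*9 = trans (^-congʳ x (≡.sym (ℕ.*-assoc (tri n) 3 3)))
      (trans (x^*3 (tri n ℕ.* 3)) (σ-cong (x^*3 (tri n))))

  ψ-dissection : ψ ≈ σ α + x * σ (σ ψ)
  ψ-dissection = ≈[]⇒≈ λ k → ≈[]-trans
    (≈[]-sym (≈[]-mono (ℕ.m≤m*n k 3) (ψ-≈[] (k ℕ.* 3)))) (≈[]-trans
    (≈⇒≈[] (triSum-dissection k))
    (+-cong[] (σ-cong[] (α-≈[] k)) (*-cong[] ≈[]-refl (σ-cong[] (σ-cong[] (ψ-≈[] k))))))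

  b : Series
  b = σ ψ

  U₀ψ : U 0 ψ ≈ α
  U₀ψ = begin
    U 0 ψ                             ≈⟨ U-cong 0 ψ-dissection ⟩
    U 0 (σ α) + U 0 (x * σ b)         ≈⟨ +-cong (U₀-σ α) (U-cong 0 (sym (-‿distribˡ-* q (σ b)))) ⟩
    α - U 0 (q * σ b)                 ≈⟨ +-congˡ (-‿cong (trans (U₀-q* (σ b)) (*-congˡ (U₂-σ b)))) ⟩
    α - q * 0#                        ≈⟨ solve 2 (λ α q → α :- q :* con (+ 0) := α) refl α q ⟩
    α                                 ∎

  U₁ψ : U 1 ψ ≈ - b
  U₁ψ = begin
    U 1 ψ                             ≈⟨ U-cong 1 ψ-dissection ⟩
    U 1 (σ α) + U 1 (x * σ b)         ≈⟨ +-cong (U₁-σ α) (U-cong 1 (sym (-‿distribˡ-* q (σ b)))) ⟩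
    0# - U 1 (q * σ b)                ≈⟨ +-congˡ (-‿cong (trans (U₁-q* (σ b)) (U₀-σ b))) ⟩
    0# - b                            ≈⟨ +-identityˡ (- b) ⟩
    - b                               ∎

  -- No triangular number is 2 modulo 3.
  U₂ψ : U 2 ψ ≈ 0#
  U₂ψ = begin
    U 2 ψ                             ≈⟨ U-cong 2 ψ-dissection ⟩
    U 2 (σ α) + U 2 (x * σ b)         ≈⟨ +-cong (U₂-σ α) (U-cong 2 (sym (-‿distribˡ-* q (σ b)))) ⟩
    0# - U 2 (q * σ b)                ≈⟨ +-congˡ (-‿cong (trans (U₂-q* (σ b)) (U₁-σ b))) ⟩
    0# - 0#                           ≈⟨ -‿inverseʳ 0# ⟩
    0#                                ∎

  1-x^-cancel : ∀ n {u v} → (1# - x ^ suc n) * u ≈ (1# - x ^ suc n) * v → u ≈ v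
  1-x^-cancel n = Geometric.1-f-cancel (x ^ suc n) (^suc-head x-head n)

  x^even : ∀ n → x ^ (n ℕ.* 2) ≈ q ^ (n ℕ.* 2)
  x^even zero    = refl
  x^even (suc n) = trans (*-congˡ (*-congˡ (x^even n)))
    (solve 2 (λ q u → (:- q) :* ((:- q) :* u) := q :* (q :* u)) refl q _)

  -- B k enumerates the partitions counted by P with parts at most k, so that
  -- B (2n) = ∏ (1 - x^{2k-1}) / (1 - x^{2k}) over 1 ≤ k ≤ n.
  module Reciprocal (P : Series) (B : ℕ → Series)
    (B-zero : B 0 ≈ 1#)
    (B-odd : ∀ n → B (suc (n ℕ.* 2)) ≈ B (n ℕ.* 2) + q ^ suc (n ℕ.* 2) * B (n ℕ.* 2))
    (B-even : ∀ n → B (suc n ℕ.* 2) ≈ B (suc (n ℕ.* 2)) + q ^ (suc n ℕ.* 2) * B (suc n ℕ.* 2))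
    (B→P : ∀ k → B k ≈[ k ] P)
    where

    r : ℕ → Series
    r n = B (n ℕ.* 2)

    -- The sign in `x` = -q sorts the parts by parity: 1 - x^(2n+1) = 1 + q^(2n+1) belongs to an odd
    -- part used at most once, and 1 - x^(2n+2) = 1 - q^(2n+2) is the denominator for an even part
    -- used arbitrarily often.
    r-suc : ∀ n → r (suc n) * (1# - x ^ (suc n ℕ.* 2)) ≈ r n * (1# - x ^ suc (n ℕ.* 2))
    r-suc n = begin
      r (suc n) * (1# - x ^ (suc n ℕ.* 2))
        ≈⟨ *-congˡ (+-congˡ (-‿cong (x^even (suc n)))) ⟩
      r (suc n) * (1# - q ^ (suc n ℕ.* 2))
        ≈⟨ solve 2 (λ b u → b :* (con (+ 1) :- u) := b :- u :* b) refl (r (suc n)) _ ⟩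
      r (suc n) - q ^ (suc n ℕ.* 2) * r (suc n)
        ≈⟨ +-congʳ (trans (B-even n) (+-congʳ (B-odd n))) ⟩
      r n + q ^ suc (n ℕ.* 2) * r n + q ^ (suc n ℕ.* 2) * r (suc n) - q ^ (suc n ℕ.* 2) * r (suc n)
        ≈⟨ solve 4 (λ b q u w → b :+ q :* u :* b :+ w :- w := b :* (con (+ 1) :- (:- q) :* u))
             refl (r n) q (q ^ (n ℕ.* 2)) _ ⟩
      r n * (1# - x * q ^ (n ℕ.* 2))
        ≈⟨ *-congˡ (+-congˡ (-‿cong (*-congˡ (x^even n)))) ⟨
      r n * (1# - x ^ suc (n ℕ.* 2)) ∎

    r→P : ∀ n → r n ≈[ n ] P
    r→P n = ≈[]-mono (ℕ.m≤m*n n 2) (B→P (n ℕ.* 2))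

    -- On the right of Gauss' finite identity the summands with s ≥ 1 carry x^((2n+1)s) and vanish
    -- modulo qⁿ. Only `r 0` = 1 remains; n = 0 is apart because the sum is then empty.
    r*ψ : ∀ n → r n * ψ ≈[ n ] 1#
    r*ψ zero    .at< _ ()
    r*ψ (suc n) =
      ≈[]-trans (*-cong[] ≈[]-refl (≈[]-sym (≈[]-mono (ℕ.m≤m*n (suc n) 2) (ψ-≈[] (suc n ℕ.* 2)))))
      (≈[]-trans (≈⇒≈[] (Gauss.shanks x r r-suc (λ n → 1-x^-cancel (suc (n ℕ.* 2))) (suc n)))
      (≈[]-trans (∑-≈[]-head (λ s → *-zeroʳ[] (r (suc s)) (y^≈0 s)) n)
      (≈⇒≈[] (trans (*-identityʳ (r 0)) B-zero))))
      where
      y^≈0 : ∀ s → (x ^ suc (suc n ℕ.* 2)) ^ suc s ≈[ suc n ] 0#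
      y^≈0 s = ≈[]-trans (≈⇒≈[] (^-assocʳ x (suc (suc n ℕ.* 2)) (suc s)))
        (x^≈[]0 (ℕ.≤-trans (ℕ.m≤n⇒m≤1+n (ℕ.m≤m*n (suc n) 2)) (ℕ.m≤m*n (suc (suc n ℕ.* 2)) (suc s))))

    P*ψ : P * ψ ≈ 1#
    P*ψ = ≈[]⇒≈ λ n → ≈[]-trans (*-cong[] (≈[]-sym (r→P n)) ≈[]-refl) (r*ψ n)

    ψ*P : ψ * P ≈ 1#
    ψ*P = trans (*-comm ψ P) P*ψ

    -- The monomials of `W₁` and `W₂` are the residue patterns with sum 1 and 2 modulo 3. A factor
    -- `q` is a carry, where the residues add up to 4 or 5.
    p₀ p₁ p₂ D W₁ W₂ : Series
    p₀ = U 0 P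
    p₁ = U 1 P
    p₂ = U 2 P
    D  = α * α * α - q * (b * b * b)
    W₁ = p₀ * p₀ * p₁ + q * (p₀ * p₂ * p₂ + p₁ * p₁ * p₂)
    W₂ = p₀ * p₀ * p₂ + p₀ * p₁ * p₁ + q * (p₁ * p₂ * p₂)

    U₁-P³ : U 1 (P * (P * P)) ≈ W₁ + W₁ + W₁
    U₁-P³ = begin
      U 1 (P * (P * P)) ≈⟨ U₁-* P (P * P) ⟩
      p₀ * U 1 (P * P) + p₁ * U 0 (P * P) + p₂ * (q * U 2 (P * P))
        ≈⟨ +-cong (+-cong (*-congˡ (U₁-* P P)) (*-congˡ (U₀-* P P))) (*-congˡ (*-congˡ (U₂-* P P))) ⟩
      _ ≈⟨ solve 4 (λ a b c q →
             a :* (a :* b :+ b :* a :+ c :* (q :* c)) :+ b :* (a :* a :+ b :* (q :* c) :+ c :* (q :* b))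
               :+ c :* (q :* (a :* c :+ b :* b :+ c :* a))
             := let w = a :* a :* b :+ q :* (a :* c :* c :+ b :* b :* c) in w :+ w :+ w)
             refl p₀ p₁ p₂ q ⟩
      W₁ + W₁ + W₁ ∎

    U₂-P³ : U 2 (P * (P * P)) ≈ W₂ + W₂ + W₂
    U₂-P³ = begin
      U 2 (P * (P * P)) ≈⟨ U₂-* P (P * P) ⟩
      p₀ * U 2 (P * P) + p₁ * U 1 (P * P) + p₂ * U 0 (P * P)
        ≈⟨ +-cong (+-cong (*-congˡ (U₂-* P P)) (*-congˡ (U₁-* P P))) (*-congˡ (U₀-* P P)) ⟩
      _ ≈⟨ solve 4 (λ a b c q →
             a :* (a :* c :+ b :* b :+ c :* a) :+ b :* (a :* b :+ b :* a :+ c :* (q :* c))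
               :+ c :* (a :* a :+ b :* (q :* c) :+ c :* (q :* b))
             := let w = a :* a :* c :+ a :* b :* b :+ q :* (b :* c :* c) in w :+ w :+ w)
             refl p₀ p₁ p₂ q ⟩
      W₂ + W₂ + W₂ ∎

    -- The three sections of ψ P = 1 form a linear system for `p₀`, `p₁`, `p₂`, of which this is the
    -- first equation.
    e₀ : α * p₀ - q * (b * p₂) ≈ 1#
    e₀ = begin
      α * p₀ - q * (b * p₂)
        ≈⟨ solve 5 (λ α b q u v → α :* u :- q :* (b :* v) := α :* u :+ (:- b) :* (q :* v) :+ con (+ 0) :* (q :* u))
             refl α b q p₀ p₂ ⟩
      α * p₀ + (- b) * (q * p₂) + 0# * (q * p₀)
        -- The zero term is brought to the shape of the product formula, where section 2 of ψ meets
        -- section 1 of `P`.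
        ≈⟨ +-congˡ (solve 2 (λ u v → con (+ 0) :* u := con (+ 0) :* v) refl (q * p₀) (q * p₁)) ⟩
      α * p₀ + (- b) * (q * p₂) + 0# * (q * p₁)
        ≈⟨ +-cong (+-cong (*-congʳ U₀ψ) (*-congʳ U₁ψ)) (*-congʳ U₂ψ) ⟨
      _ ≈⟨ U₀-* ψ P ⟨
      U 0 (ψ * P) ≈⟨ U-cong 0 ψ*P ⟩
      U 0 1#      ≈⟨ U-cong 0 σ-1 ⟨
      U 0 (σ 1#)  ≈⟨ U₀-σ 1# ⟩
      1# ∎

    e₁ : α * p₁ - b * p₀ ≈ 0#
    e₁ = begin
      α * p₁ - b * p₀
        ≈⟨ solve 5 (λ α b u v w → α :* u :- b :* v := α :* u :+ (:- b) :* v :+ con (+ 0) :* w)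
             refl α b p₁ p₀ (q * p₂) ⟩
      α * p₁ + (- b) * p₀ + 0# * (q * p₂)
        ≈⟨ +-cong (+-cong (*-congʳ U₀ψ) (*-congʳ U₁ψ)) (*-congʳ U₂ψ) ⟨
      _ ≈⟨ U₁-* ψ P ⟨
      U 1 (ψ * P) ≈⟨ U-cong 1 (trans ψ*P (sym σ-1)) ⟩
      U 1 (σ 1#)  ≈⟨ U₁-σ 1# ⟩
      0# ∎

    e₂ : α * p₂ - b * p₁ ≈ 0#
    e₂ = begin
      α * p₂ - b * p₁
        ≈⟨ solve 5 (λ α b u v w → α :* u :- b :* v := α :* u :+ (:- b) :* v :+ con (+ 0) :* w)
             refl α b p₂ p₁ p₀ ⟩
      α * p₂ + (- b) * p₁ + 0# * p₀
        ≈⟨ +-cong (+-cong (*-congʳ U₀ψ) (*-congʳ U₁ψ)) (*-congʳ U₂ψ) ⟨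
      _ ≈⟨ U₂-* ψ P ⟨
      U 2 (ψ * P) ≈⟨ U-cong 2 (trans ψ*P (sym σ-1)) ⟩
      U 2 (σ 1#)  ≈⟨ U₂-σ 1# ⟩
      0# ∎

    -- Cramer's rule: `e₀`, `e₁`, `e₂` are combined with cofactors of the system as multipliers. The
    -- right side is the cofactor multiplying `e₀`, the only equation with nonzero right side.
    p₀*D : p₀ * D ≈ α * α
    p₀*D = begin
      p₀ * D
        ≈⟨ solve 6 (λ α b q u v w → u :* (α :* α :* α :- q :* (b :* b :* b)) :=
             α :* α :* (α :* u :- q :* (b :* w)) :+ q :* b :* b :* (α :* v :- b :* u)
               :+ q :* α :* b :* (α :* w :- b :* v)) refl α b q p₀ p₁ p₂ ⟩
      _ ≈⟨ +-cong (+-cong (*-congˡ e₀) (*-congˡ e₁)) (*-congˡ e₂) ⟩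
      _ ≈⟨ solve 3 (λ a b c → a :* con (+ 1) :+ b :* con (+ 0) :+ c :* con (+ 0) := a) refl _ _ _ ⟩
      α * α ∎

    p₁*D : p₁ * D ≈ α * b
    p₁*D = begin
      p₁ * D
        ≈⟨ solve 6 (λ α b q u v w → v :* (α :* α :* α :- q :* (b :* b :* b)) :=
             α :* b :* (α :* u :- q :* (b :* w)) :+ α :* α :* (α :* v :- b :* u)
               :+ q :* b :* b :* (α :* w :- b :* v)) refl α b q p₀ p₁ p₂ ⟩
      _ ≈⟨ +-cong (+-cong (*-congˡ e₀) (*-congˡ e₁)) (*-congˡ e₂) ⟩
      _ ≈⟨ solve 3 (λ a b c → a :* con (+ 1) :+ b :* con (+ 0) :+ c :* con (+ 0) := a) refl _ _ _ ⟩
      α * b ∎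

    p₂*D : p₂ * D ≈ b * b
    p₂*D = begin
      p₂ * D
        ≈⟨ solve 6 (λ α b q u v w → w :* (α :* α :* α :- q :* (b :* b :* b)) :=
             b :* b :* (α :* u :- q :* (b :* w)) :+ α :* b :* (α :* v :- b :* u)
               :+ α :* α :* (α :* w :- b :* v)) refl α b q p₀ p₁ p₂ ⟩
      _ ≈⟨ +-cong (+-cong (*-congˡ e₀) (*-congˡ e₁)) (*-congˡ e₂) ⟩
      _ ≈⟨ solve 3 (λ a b c → a :* con (+ 1) :+ b :* con (+ 0) :+ c :* con (+ 0) := a) refl _ _ _ ⟩
      b * b ∎

    divide-D : ∀ {D⁻¹} → D * D⁻¹ ≈ 1# → ∀ {p u} → p * D ≈ u → p ≈ u * D⁻¹
    divide-D {D⁻¹} DD⁻¹≈1 {p} {u} pD≈u = begin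
      p              ≈⟨ *-identityʳ p ⟨
      p * 1#         ≈⟨ *-congˡ DD⁻¹≈1 ⟨
      p * (D * D⁻¹)  ≈⟨ *-assoc p D D⁻¹ ⟨
      p * D * D⁻¹    ≈⟨ *-congʳ pD≈u ⟩
      u * D⁻¹        ∎

    W₁-cong : ∀ {u v w} → p₀ ≈ u → p₁ ≈ v → p₂ ≈ w →
              W₁ ≈ u * u * v + q * (u * w * w + v * v * w)
    W₁-cong p₀≈ p₁≈ p₂≈ = +-cong (*-cong (*-cong p₀≈ p₀≈) p₁≈)
      (*-congˡ (+-cong (*-cong (*-cong p₀≈ p₂≈) p₂≈) (*-cong (*-cong p₁≈ p₁≈) p₂≈)))

    -- Characteristic 3

    module Mod3 (1+1+1≈0 : R.1# R.+ R.1# R.+ R.1# R.≈ R.0#)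
                (c³≈c : ∀ c → c R.* c R.* c R.≈ c) where

      private
        F : ∀ f → f * f * f ≈ σ f
        F = frobenius 1+1+1≈0 c³≈c

      drop-triple : ∀ u v → u + (1# + 1# + 1#) * v ≈ u
      drop-triple u v =
        trans (+-congˡ (trans (*-congʳ (triple 1+1+1≈0 c³≈c)) (zeroˡ v))) (+-identityʳ u)

      D≈ψ : D ≈ ψ
      D≈ψ = begin
        α * α * α - q * (b * b * b)  ≈⟨ +-cong (F α) (-‿cong (*-congˡ (F b))) ⟩
        σ α - q * σ b                ≈⟨ +-congˡ (-‿distribˡ-* q (σ b)) ⟩
        σ α + x * σ b                ≈⟨ ψ-dissection ⟨
        ψ                            ∎

      D*P : D * P ≈ 1#
      D*P = trans (*-congʳ D≈ψ) ψ*P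

      bP³ : b * (P * P * P) ≈ 1#
      bP³ = begin
        b * (P * P * P)              ≈⟨ *-congʳ (F ψ) ⟨
        ψ * ψ * ψ * (P * P * P)      ≈⟨ solve 2 (λ s p → s :* s :* s :* (p :* p :* p) := (s :* p) :* (s :* p) :* (s :* p)) refl ψ P ⟩
        ψ * P * (ψ * P) * (ψ * P)    ≈⟨ *-cong (*-cong ψ*P ψ*P) ψ*P ⟩
        1# * 1# * 1#                 ≈⟨ trans (*-identityʳ _) (*-identityʳ 1#) ⟩
        1#                           ∎

      p₀≈ : p₀ ≈ α * α * P
      p₀≈ = divide-D D*P p₀*D
      p₁≈ : p₁ ≈ α * b * P
      p₁≈ = divide-D D*P p₁*D
      p₂≈ : p₂ ≈ b * b * P
      p₂≈ = divide-D D*P p₂*D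

      Uᵢp₂ : ∀ i → i < 3 → U i p₂ ≈ ψ * ψ * U i P
      Uᵢp₂ i i<3 = trans (U-cong i (trans p₂≈ (*-congʳ (sym (σ-* ψ ψ))))) (U-σ* i i<3 (ψ * ψ) P)

      U₀p₂ : U 0 p₂ ≈ α * α * ψ
      U₀p₂ = begin
        U 0 p₂                ≈⟨ Uᵢp₂ 0 (s≤s z≤n) ⟩
        ψ * ψ * p₀            ≈⟨ *-congˡ p₀≈ ⟩
        ψ * ψ * (α * α * P)   ≈⟨ solve 3 (λ s a p → s :* s :* (a :* a :* p) := a :* a :* s :* (s :* p)) refl ψ α P ⟩
        α * α * ψ * (ψ * P)   ≈⟨ *-congˡ ψ*P ⟩
        α * α * ψ * 1#        ≈⟨ *-identityʳ _ ⟩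
        α * α * ψ             ∎

      U₁p₂ : U 1 p₂ ≈ α * b * ψ
      U₁p₂ = begin
        U 1 p₂                ≈⟨ Uᵢp₂ 1 (s≤s (s≤s z≤n)) ⟩
        ψ * ψ * p₁            ≈⟨ *-congˡ p₁≈ ⟩
        ψ * ψ * (α * b * P)   ≈⟨ solve 4 (λ s a b p → s :* s :* (a :* b :* p) := a :* b :* s :* (s :* p)) refl ψ α b P ⟩
        α * b * ψ * (ψ * P)   ≈⟨ *-congˡ ψ*P ⟩
        α * b * ψ * 1#        ≈⟨ *-identityʳ _ ⟩
        α * b * ψ             ∎

      W₁≈U₀U₂P : W₁ ≈ U 0 p₂
      W₁≈U₀U₂P = begin
        W₁ ≈⟨ W₁-cong p₀≈ p₁≈ p₂≈ ⟩
        -- The sum is α² b P³ (α³ + 2qb³), and 2 = -1 turns the bracket into `D`.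
        _ ≈⟨ solve 4 (λ a b q p →
               a :* a :* p :* (a :* a :* p) :* (a :* b :* p)
                 :+ q :* (a :* a :* p :* (b :* b :* p) :* (b :* b :* p) :+ a :* b :* p :* (a :* b :* p) :* (b :* b :* p))
               := a :* a :* (a :* a :* a :- q :* (b :* b :* b)) :* (b :* (p :* p :* p))
                 :+ con (+ 3) :* (a :* a :* b :* b :* b :* b :* q :* p :* p :* p)) refl α b q P ⟩
        _ ≈⟨ drop-triple _ _ ⟩
        α * α * D * (b * (P * P * P)) ≈⟨ *-cong (*-congˡ D≈ψ) bP³ ⟩
        α * α * ψ * 1#                ≈⟨ *-identityʳ _ ⟩
        α * α * ψ                     ≈⟨ U₀p₂ ⟨
        U 0 p₂                        ∎

      W₂≈2U₁U₂P : W₂ ≈ U 1 p₂ + U 1 p₂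
      W₂≈2U₁U₂P = begin
        W₂ ≈⟨ +-cong (+-cong (*-cong (*-cong p₀≈ p₀≈) p₂≈) (*-cong (*-cong p₀≈ p₁≈) p₁≈))
                (*-congˡ (*-cong (*-cong p₁≈ p₂≈) p₂≈)) ⟩
        -- The sum is α b² P³ (2α³ + qb³), and the bracket is 2`D` modulo 3. This 2 makes the final
        -- coefficient 6 instead of 3.
        _ ≈⟨ solve 4 (λ a b q p →
               a :* a :* p :* (a :* a :* p) :* (b :* b :* p) :+ a :* a :* p :* (a :* b :* p) :* (a :* b :* p)
                 :+ q :* (a :* b :* p :* (b :* b :* p) :* (b :* b :* p))
               := con (+ 2) :* (a :* b :* (a :* a :* a :- q :* (b :* b :* b))) :* (b :* (p :* p :* p))
                 :+ con (+ 3) :* (a :* b :* b :* b :* b :* b :* q :* p :* p :* p)) refl α b q P ⟩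
        _ ≈⟨ drop-triple _ _ ⟩
        (1# + 1#) * (α * b * D) * (b * (P * P * P)) ≈⟨ *-cong (*-congˡ (*-congˡ D≈ψ)) bP³ ⟩
        (1# + 1#) * (α * b * ψ) * 1#                ≈⟨ *-identityʳ _ ⟩
        (1# + 1#) * (α * b * ψ)                     ≈⟨ *-congˡ U₁p₂ ⟨
        (1# + 1#) * U 1 p₂                          ≈⟨ solve 1 (λ u → con (+ 2) :* u := u :+ u) refl (U 1 p₂) ⟩
        U 1 p₂ + U 1 p₂                             ∎

    -- Characteristic 2

    module Mod2 (R1+1≈0 : R.1# R.+ R.1# R.≈ R.0#) where

      double : 1# + 1# ≈ 0#
      double .at zero    = R1+1≈0
      double .at (suc n) = R.+-identityʳ _

      open Char2 double

      -- The partial Euler products in `x` and their inverses; `ρ` plays the part of `r` in the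
      -- finite pentagonal identity.
      euler ρ : ℕ → Series
      euler zero    = 1#
      euler (suc n) = euler n * (1# - x ^ suc n)
      ρ zero    = 1#
      ρ (suc n) = ρ n * Geometric.geometric (x ^ suc n) (^suc-head x-head n)

      ρ-suc : ∀ n → ρ (suc n) * (1# - x ^ suc n) ≈ ρ n
      ρ-suc n = trans (solve 3 (λ r g e → r :* g :* e := r :* (e :* g)) refl (ρ n) _ _)
        (trans (*-congˡ (Geometric.geometric-inverse (x ^ suc n) (^suc-head x-head n))) (*-identityʳ _))

      euler*ρ : ∀ n → euler n * ρ n ≈ 1#
      euler*ρ zero    = *-identityʳ 1#
      euler*ρ (suc n) = trans (solve 3 (λ f e r → f :* e :* r := f :* (r :* e)) refl (euler n) _ _)
        (trans (*-congˡ (ρ-suc n)) (euler*ρ n))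

      ρ*α : ∀ n → ρ n * α ≈[ n ] 1#
      ρ*α n =
        -- The half pair x^(pent₁ n) of the finite identity vanishes modulo qⁿ, so it may be added
        -- freely.
        ≈[]-trans (*-cong[] ≈[]-refl (≈[]-trans (≈[]-sym (α-≈[] n)) (≈[]-sym (+-identityʳ[] (x^≈[]0 (n≤pent₁ n))))))
        (≈[]-trans (≈⇒≈[] (Pentagonal.shanks x ρ ρ-suc 1-x^-cancel n))
        (≈[]-trans (∑-≈[]-head (λ s → *-zeroʳ[] (ρ (suc s)) (≈[]-trans (≈⇒≈[] (*-comm _ _)) (*-zeroʳ[] _ (y^≈0 s)))) n)
        (≈⇒≈[] (trans (*-identityˡ _) (*-identityʳ _)))))
        where
        y^≈0 : ∀ s → (x ^ n) ^ suc s ≈[ n ] 0#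
        y^≈0 s = ≈[]-trans (≈⇒≈[] (^-assocʳ x n (suc s))) (x^≈[]0 (ℕ.m≤m*n n (suc s)))

      α≈euler : ∀ n → α ≈[ n ] euler n
      α≈euler n =
        ≈[]-trans (≈⇒≈[] (sym (trans (*-congʳ (euler*ρ n)) (*-identityˡ α))))
        (≈[]-trans (≈⇒≈[] (*-assoc (euler n) (ρ n) α))
        (≈[]-trans (*-cong[] ≈[]-refl (ρ*α n)) (≈⇒≈[] (*-identityʳ _))))

      evens odds : ℕ → Series
      evens zero    = 1#
      evens (suc n) = evens n * (1# - x ^ (suc n ℕ.* 2))
      odds zero     = 1#
      odds (suc n)  = odds n * (1# - x ^ suc (n ℕ.* 2))

      r*evens : ∀ n → r n * evens n ≈ odds n
      r*evens zero    = trans (*-identityʳ _) B-zero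
      r*evens (suc n) = begin
        r (suc n) * (evens n * (1# - x ^ (suc n ℕ.* 2)))
          ≈⟨ solve 3 (λ r e f → r :* (e :* f) := r :* f :* e) refl (r (suc n)) (evens n) _ ⟩
        r (suc n) * (1# - x ^ (suc n ℕ.* 2)) * evens n
          ≈⟨ *-congʳ (r-suc n) ⟩
        r n * (1# - x ^ suc (n ℕ.* 2)) * evens n
          ≈⟨ solve 3 (λ r e f → r :* f :* e := r :* e :* f) refl (r n) (evens n) _ ⟩
        r n * evens n * (1# - x ^ suc (n ℕ.* 2))
          ≈⟨ *-congʳ (r*evens n) ⟩
        odds n * (1# - x ^ suc (n ℕ.* 2)) ∎

      euler-double : ∀ n → euler (n ℕ.* 2) ≈ odds n * evens n
      euler-double zero    = sym (*-identityʳ 1#)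
      euler-double (suc n) = trans (*-congʳ (*-congʳ (euler-double n)))
        (solve 4 (λ o e f g → o :* e :* f :* g := o :* f :* (e :* g)) refl (odds n) (evens n) _ _)

      evens-square : ∀ n → evens n ≈ euler n * euler n
      evens-square zero    = sym (*-identityʳ 1#)
      evens-square (suc n) = begin
        evens n * (1# - x ^ (suc n ℕ.* 2))
          ≈⟨ *-cong (evens-square n) (+-congˡ (-‿cong (^-congʳ x (ℕ.*-comm (suc n) 2)))) ⟩
        euler n * euler n * (1# - x ^ (suc n ℕ.+ (suc n ℕ.+ 0)))
          ≈⟨ *-congˡ (+-congˡ (-‿cong (trans (^-homo-* x (suc n) (suc n ℕ.+ 0))
               (*-congˡ (^-congʳ x (ℕ.+-identityʳ (suc n))))))) ⟩
        euler n * euler n * (1# - y * y)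
          ≈⟨ solve 2 (λ f y → f :* f :* (con (+ 1) :- y :* y) :=
               f :* (con (+ 1) :- y) :* (f :* (con (+ 1) :- y)) :+ con (+ 2) :* (f :* f :* (y :- y :* y)))
               refl (euler n) y ⟩
        euler (suc n) * euler (suc n) + (1# + 1#) * _
          ≈⟨ drop-double _ _ ⟩
        euler (suc n) * euler (suc n) ∎
        where y = x ^ suc n

      -- In the limit α is odds times evens and ψ is evens over odds, so α ψ is the square of evens;
      -- and evens is itself α² because 1 - y² = (1 - y)² modulo 2.
      α*ψ : α * ψ ≈ α * (α * α * α)
      α*ψ = ≈[]⇒≈ λ n →
        ≈[]-trans (*-cong[] (≈[]-mono (ℕ.m≤m*n n 2) (α≈euler (n ℕ.* 2))) ≈[]-refl)
        (≈[]-trans (≈⇒≈[] (begin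
          euler (n ℕ.* 2) * ψ               ≈⟨ *-congʳ (trans (euler-double n) (*-congʳ (sym (r*evens n)))) ⟩
          r n * evens n * evens n * ψ       ≈⟨ solve 3 (λ r e s → r :* e :* e :* s := e :* e :* (r :* s)) refl (r n) (evens n) ψ ⟩
          evens n * evens n * (r n * ψ)     ≈⟨ *-congʳ (*-cong (evens-square n) (evens-square n)) ⟩
          euler n * euler n * (euler n * euler n) * (r n * ψ) ∎))
        (≈[]-trans (*-cong[] (*-cong[] (*-cong[] (f≈ n) (f≈ n)) (*-cong[] (f≈ n) (f≈ n))) (r*ψ n))
        (≈⇒≈[] (solve 1 (λ a → a :* a :* (a :* a) :* con (+ 1) := a :* (a :* a :* a)) refl α))))
        where
        f≈ : ∀ n → euler n ≈[ n ] α
        f≈ n = ≈[]-sym (α≈euler n)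

      -- α may be cancelled because its constant term is 1: it is `1# - f` for f = 1 - α.
      α³≈ψ : α * α * α ≈ ψ
      α³≈ψ = sym (Geometric.1-f-cancel (1# - α) head (trans (1-[1-α]* ψ) (trans α*ψ (sym (1-[1-α]* _)))))
        where
        1-[1-α]* : ∀ u → (1# - (1# - α)) * u ≈ α * u
        1-[1-α]* u = solve 2 (λ a u → (con (+ 1) :- (con (+ 1) :- a)) :* u := a :* u) refl α u
        α0≈1 : α 0 R.≈ R.1#
        α0≈1 = R.trans (R.+-identityˡ _) (R.trans (R.+-congˡ (^suc-head {x} x-head 0)) (R.+-identityʳ _))
        head : (1# - α) 0 R.≈ R.0#
        head = R.trans (R.+-congˡ (R.-‿cong α0≈1)) (R.-‿inverseʳ R.1#)

      b≈σα³ : b ≈ σ α * σ α * σ α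
      b≈σα³ = trans (σ-cong (sym α³≈ψ)) (trans (σ-* (α * α) α) (*-congʳ (σ-* α α)))

      -- Modulo 2 and with α³ replaced by ψ, `E ψ b` is exactly the difference between D b and ψ⁴.
      E : Series → Series → Series
      E f g = f * f * (f * f) + f * g + q * (g * g * (g * g))

      σ-E : ∀ f g → σ (E f g) ≈ σ f * σ f * (σ f * σ f) + σ f * σ g
                              + q * (q * q) * (σ g * σ g * (σ g * σ g))
      σ-E f g = trans (σ-+ _ _) (+-cong (trans (σ-+ _ _) (+-cong (σ-⁴ f) (σ-* f g)))
                  (trans (σ-* q _) (*-cong σ-q (σ-⁴ g))))
        where
        σ-⁴ : ∀ f → σ (f * f * (f * f)) ≈ σ f * σ f * (σ f * σ f)
        σ-⁴ f = trans (σ-* (f * f) (f * f)) (*-cong (σ-* f f) (σ-* f f))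

      -- Insert ψ = σα - q σb into ψ⁴ + ψb. Modulo 2 the terms without q are σα (σα³ + b), which
      -- vanish as b ≡ σα³. The others, together with q b⁴, are q (b⁴ + b σb + q³ σb⁴), the
      -- substituted `E` since `b` = `σ ψ`.
      E-fixed : E ψ b ≈ q * σ (E ψ b)
      E-fixed = begin
        ψ * ψ * (ψ * ψ) + ψ * b + q * (b * b * (b * b))
          ≈⟨ +-congʳ (+-cong (*-cong (*-cong ψ≈ ψ≈) (*-cong ψ≈ ψ≈)) (*-congʳ ψ≈)) ⟩
        _ ≈⟨ solve 4 (λ a q b c →
               (a :+ (:- q) :* c) :* (a :+ (:- q) :* c) :* ((a :+ (:- q) :* c) :* (a :+ (:- q) :* c))
                 :+ (a :+ (:- q) :* c) :* b :+ q :* (b :* b :* (b :* b))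
               := (q :* (b :* b :* (b :* b) :+ b :* c :+ q :* (q :* q) :* (c :* c :* (c :* c)))
                 :+ con (+ 2) :* (con (+ 3) :* a :* a :* q :* q :* c :* c :- con (+ 2) :* a :* a :* a :* q :* c
                                  :- con (+ 2) :* a :* q :* q :* q :* c :* c :* c :- q :* b :* c))
                 :+ a :* (a :* a :* a :+ b))
               refl (σ α) q b (σ b) ⟩
        _ ≈⟨ +-cong (drop-double _ _) (*-congˡ (+-congˡ b≈σα³)) ⟩
        _ + σ α * (σ α * σ α * σ α + σ α * σ α * σ α)
          ≈⟨ solve 2 (λ u a → u :+ a :* (a :* a :* a :+ a :* a :* a) := u :+ con (+ 2) :* (a :* a :* a :* a))
               refl _ (σ α) ⟩
        _ ≈⟨ drop-double _ _ ⟩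
        q * (b * b * (b * b) + b * σ b + q * (q * q) * (σ b * σ b * (σ b * σ b)))
          ≈⟨ *-congˡ (σ-E ψ b) ⟨
        q * σ (E ψ b) ∎
        where
        ψ≈ = ψ-dissection

      -- A contraction: `σ` does not lower the order and `q` raises it, so vanishing modulo q^k
      -- implies vanishing modulo q^(k+1).
      qσ-fixed⇒0 : ∀ {f} → f ≈ q * σ f → f ≈ 0#
      qσ-fixed⇒0 {f} f≈ = ≈[]⇒≈ go
        where
        go : ∀ k → f ≈[ k ] 0#
        go zero    .at< _ ()
        go (suc k) = ≈[]-trans (≈⇒≈[] f≈) (*-suc[] R.refl (≈[]-trans (σ-cong[] (go k)) (≈⇒≈[] σ-0)))

      D*b : D * b ≈ ψ * ψ * (ψ * ψ)
      D*b = begin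
        D * b ≈⟨ *-congʳ (+-congʳ α³≈ψ) ⟩
        (ψ - q * (b * b * b)) * b
          ≈⟨ solve 3 (λ s q b → (s :- q :* (b :* b :* b)) :* b :=
               s :* s :* (s :* s) :+ (s :* s :* (s :* s) :+ s :* b :+ q :* (b :* b :* (b :* b)))
                 :+ con (+ 2) :* (:- (s :* s :* (s :* s)) :- q :* (b :* b :* (b :* b)))) refl ψ q b ⟩
        _ ≈⟨ drop-double _ _ ⟩
        ψ * ψ * (ψ * ψ) + E ψ b
          ≈⟨ +-congˡ (qσ-fixed⇒0 E-fixed) ⟩
        ψ * ψ * (ψ * ψ) + 0#
          ≈⟨ +-identityʳ _ ⟩
        ψ * ψ * (ψ * ψ) ∎

      P⁴ D⁻¹ : Series
      P⁴  = P * P * (P * P)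
      D⁻¹ = b * P⁴

      D*D⁻¹ : D * D⁻¹ ≈ 1#
      D*D⁻¹ = begin
        D * (b * P⁴)              ≈⟨ *-assoc D b P⁴ ⟨
        D * b * P⁴                ≈⟨ *-congʳ D*b ⟩
        ψ * ψ * (ψ * ψ) * P⁴
          ≈⟨ solve 2 (λ s p → s :* s :* (s :* s) :* (p :* p :* (p :* p)) :=
               s :* p :* (s :* p) :* (s :* p :* (s :* p))) refl ψ P ⟩
        ψ * P * (ψ * P) * (ψ * P * (ψ * P))
          ≈⟨ *-cong (*-cong ψ*P ψ*P) (*-cong ψ*P ψ*P) ⟩
        1# * 1# * (1# * 1#)       ≈⟨ trans (*-cong (*-identityʳ 1#) (*-identityʳ 1#)) (*-identityʳ 1#) ⟩
        1#                        ∎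

      p₀≈ : p₀ ≈ α * α * D⁻¹
      p₀≈ = divide-D D*D⁻¹ p₀*D
      p₁≈ : p₁ ≈ α * b * D⁻¹
      p₁≈ = divide-D D*D⁻¹ p₁*D
      p₂≈ : p₂ ≈ b * b * D⁻¹
      p₂≈ = divide-D D*D⁻¹ p₂*D

      -- Besides the square of section 0, exponents divisible by 3 arise only from sections 1 and 2
      -- together, in two orders that cancel.
      U₀-square : ∀ f → U 0 (f * f) ≈ U 0 f * U 0 f
      U₀-square f = trans (U₀-* f f) (trans
        (solve 4 (λ a b c q → a :* a :+ b :* (q :* c) :+ c :* (q :* b) := a :* a :+ con (+ 2) :* (b :* q :* c))
          refl (U 0 f) (U 1 f) (U 2 f) q)
        (drop-double _ _))

      -- Here `p₂` = b³ P⁴: the cube is a series in q³ and leaves the section, and the fourth power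
      -- is a repeated square.
      U₀p₂ : U 0 p₂ ≈ ψ * ψ * ψ * (p₀ * p₀ * (p₀ * p₀))
      U₀p₂ = begin
        U 0 p₂                       ≈⟨ U-cong 0 (trans p₂≈ (sym (*-assoc (b * b) b P⁴))) ⟩
        U 0 (b * b * b * P⁴)         ≈⟨ U-cong 0 (*-congʳ (trans (σ-* (ψ * ψ) ψ) (*-congʳ (σ-* ψ ψ)))) ⟨
        U 0 (σ (ψ * ψ * ψ) * P⁴)     ≈⟨ U-σ* 0 (s≤s z≤n) (ψ * ψ * ψ) P⁴ ⟩
        ψ * ψ * ψ * U 0 P⁴           ≈⟨ *-congˡ (trans (U₀-square (P * P)) (*-cong (U₀-square P) (U₀-square P))) ⟩
        ψ * ψ * ψ * (p₀ * p₀ * (p₀ * p₀)) ∎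

      -- D⁻¹ = b P⁴ turns both sides into α⁵ b⁴ P¹², once α³ ≈ ψ and P ψ ≈ 1 are used on the right.
      W₁≈U₀U₂P : W₁ ≈ U 0 p₂
      W₁≈U₀U₂P = begin
        W₁ ≈⟨ W₁-cong p₀≈ p₁≈ p₂≈ ⟩
        _ ≈⟨ solve 4 (λ a b q d →
               a :* a :* d :* (a :* a :* d) :* (a :* b :* d)
                 :+ q :* (a :* a :* d :* (b :* b :* d) :* (b :* b :* d) :+ a :* b :* d :* (a :* b :* d) :* (b :* b :* d))
               := a :* a :* a :* a :* a :* b :* (d :* d :* d)
                 :+ con (+ 2) :* (a :* a :* b :* b :* b :* b :* q :* d :* d :* d)) refl α b q D⁻¹ ⟩
        _ ≈⟨ drop-double _ _ ⟩
        α * α * α * α * α * b * (D⁻¹ * D⁻¹ * D⁻¹)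
          ≈⟨ *-identityʳ _ ⟨
        α * α * α * α * α * b * (D⁻¹ * D⁻¹ * D⁻¹) * 1#
          ≈⟨ *-congˡ unit ⟨
        α * α * α * α * α * b * (D⁻¹ * D⁻¹ * D⁻¹) * (α * α * α * P * (ψ * P) * (ψ * P) * (ψ * P))
          ≈⟨ solve 5 (λ a b d s p →
               a :* a :* a :* a :* a :* b :* (d :* d :* d) :* (a :* a :* a :* p :* (s :* p) :* (s :* p) :* (s :* p)) :=
               s :* s :* s :* (a :* a :* d :* (a :* a :* d) :* (a :* a :* d :* (a :* a :* (b :* (p :* p :* (p :* p)))))))
               refl α b D⁻¹ ψ P ⟩
        ψ * ψ * ψ * (α * α * D⁻¹ * (α * α * D⁻¹) * (α * α * D⁻¹ * (α * α * D⁻¹)))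
          ≈⟨ *-congˡ (*-cong (*-cong p₀≈ p₀≈) (*-cong p₀≈ p₀≈)) ⟨
        ψ * ψ * ψ * (p₀ * p₀ * (p₀ * p₀))
          ≈⟨ U₀p₂ ⟨
        U 0 p₂ ∎
        where
        unit : α * α * α * P * (ψ * P) * (ψ * P) * (ψ * P) ≈ 1#
        unit = begin
          α * α * α * P * (ψ * P) * (ψ * P) * (ψ * P)
            ≈⟨ *-cong (*-cong (*-cong (trans (*-congʳ α³≈ψ) ψ*P) ψ*P) ψ*P) ψ*P ⟩
          1# * 1# * 1# * 1#
            ≈⟨ trans (*-identityʳ _) (trans (*-identityʳ _) (*-identityʳ 1#)) ⟩
          1# ∎

-- Enumeration of pod partitions

module Enumeration where
  open import Data.Nat.Base using (_+_; _*_)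
  open import Data.Product.Base using (_×_)
  open ≡ using (refl; sym; trans; cong; cong₂; subst)
  open Equivalence using (to; from)

  -- Every counting identity below goes through this, so that only equivalence of membership has to
  -- be proved.
  unique⇒length≡ : ∀ {A : Set} {xs ys : List A} → Unique xs → Unique ys →
                   (∀ {z} → z ∈ xs ⇔ z ∈ ys) → length xs ≡ length ys
  unique⇒length≡ xs! ys! xs⇔ys = ↭-length (∼bag⇒↭ (unique∧set⇒bag xs! ys! xs⇔ys))

  IsBoundedPodOf : ℕ → ℕ → List ℕ → Set
  IsBoundedPodOf m n ps = IsPodOf n ps × All (_≤ m) ps

  -- Opaque, since otherwise m and n could not be inferred from bounded m n.
  opaque
    bounded : ℕ → ℕ → List (List ℕ)
    bounded m n = filter (all? (ℕ._≤? m)) (podPartitions n)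

    ∈-bounded : ∀ {m n ps} → ps ∈ bounded m n ⇔ IsBoundedPodOf m n ps
    ∈-bounded {m} {n} = mk⇔
      (λ ps∈ → let ps∈′ , ≤m = ∈-filter⁻ (all? (ℕ._≤? m)) {xs = podPartitions n} ps∈ in
        to (∈-podPartitions {n}) ps∈′ , ≤m)
      (λ (isPod , ≤m) → ∈-filter⁺ (all? (ℕ._≤? m)) (from ∈-podPartitions isPod) ≤m)

    bounded-unique : ∀ m n → Unique (bounded m n)
    bounded-unique m n = Unique.filter⁺ (all? (ℕ._≤? m)) (podPartitions-unique n)

  parts≤sum : ∀ ps → All (_≤ sum ps) ps
  parts≤sum []       = []
  parts≤sum (p ∷ ps) = ℕ.m≤m+n p (sum ps)
    ∷ All.map (λ q≤ → ℕ.≤-trans q≤ (ℕ.m≤n+m (sum ps) p)) (parts≤sum ps)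

  count : ℕ → ℕ → ℕ
  count m n = length (bounded m n)

  count-≤ : ∀ {m n} → n ≤ m → count m n ≡ pod n
  count-≤ {m} {n} n≤m = unique⇒length≡ (bounded-unique m n) (podPartitions-unique n) (mk⇔
    (λ ps∈ → from ∈-podPartitions (proj₁ (to ∈-bounded ps∈)))
    (λ ps∈ → let isPod = to (∈-podPartitions {n}) ps∈ in
      from ∈-bounded (isPod , All.map (λ p≤ → ℕ.≤-trans (subst (_ ≤_) (proj₂ isPod) p≤) n≤m) (parts≤sum _))))

  count-0-0 : count 0 0 ≡ 1
  count-0-0 = count-≤ {0} {0} z≤n

  count-0-suc : ∀ n → count 0 (suc n) ≡ 0
  count-0-suc n = unique⇒length≡ {ys = []} (bounded-unique 0 (suc n)) [] (mk⇔
    (λ ps∈ → impossible (to ∈-bounded ps∈)) (λ ()))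
    where
    impossible : ∀ {ps} → IsBoundedPodOf 0 (suc n) ps → ps ∈ []
    impossible {[]}     ((_ , ()) , _)
    impossible {p ∷ ps} ((((_ , 0<p ∷ _) , _) , _) , p≤0 ∷ _) = contradiction p≤0 (ℕ.<⇒≱ 0<p)

  count-suc-< : ∀ {m n} → n ≤ m → count (suc m) n ≡ count m n
  count-suc-< n≤m = trans (count-≤ (ℕ.m≤n⇒m≤1+n n≤m)) (sym (count-≤ n≤m))

  head-bounds : ∀ {p ps} → Linked _≥_ (p ∷ ps) → All (_≤ p) ps
  head-bounds linked with Linked⇒AllPairs (λ p≥q q≥r → ℕ.≤-trans q≥r p≥q) linked
  ... | p≥ ∷ _ = p≥

  ∷-linked : ∀ {p ps} → All (_≤ p) ps → Linked _≥_ ps → Linked _≥_ (p ∷ ps)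
  ∷-linked []      _      = [-]
  ∷-linked (q≤p ∷ _) linked = q≤p ∷ linked

  -- When a part m + 1 is removed, the remaining parts are bounded by m′.
  module LargestPart (m m′ : ℕ)
    (remove : ∀ {ps} → IsPod (suc m ∷ ps) → IsPod ps × All (_≤ m′) ps)
    (insert : ∀ {ps} → IsPod ps → All (_≤ m′) ps → IsPod (suc m ∷ ps) × All (_≤ suc m) ps)
    where

    count-split : ∀ n → count (suc m) (suc m + n) ≡ count m (suc m + n) + count m′ n
    count-split n = trans (unique⇒length≡ (bounded-unique _ _) split-unique (mk⇔ split unsplit))
      (trans (length-++ (bounded m (suc m + n))) (cong (λ k → count m (suc m + n) + k) (length-map (suc m ∷_) (bounded m′ n))))
      where
      with-part : List (List ℕ)
      with-part = map (suc m ∷_) (bounded m′ n)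

      split-unique : Unique (bounded m (suc m + n) ++ with-part)
      split-unique = Unique.++⁺ (bounded-unique _ _) (Unique.map⁺ ∷-injectiveʳ (bounded-unique _ _)) disjoint
        where
        disjoint : ∀ {ps} → ¬ (ps ∈ bounded m (suc m + n) × ps ∈ with-part)
        disjoint (ps∈ , ps∈′) with ∈-map⁻ (suc m ∷_) ps∈′
        ... | _ , _ , refl with to (∈-bounded {m}) ps∈
        ... | _ , m<m ∷ _ = ℕ.<-irrefl refl m<m

      split : ∀ {ps} → ps ∈ bounded (suc m) (suc m + n) → ps ∈ bounded m (suc m + n) ++ with-part
      split ps∈ = go (to ∈-bounded ps∈)
        where
        go : ∀ {ps} → IsBoundedPodOf (suc m) (suc m + n) ps → ps ∈ bounded m (suc m + n) ++ with-part
        go {[]}     ((_ , ()) , _)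
        go {p ∷ ps} ((isPod , sum≡) , p≤ ∷ ps≤) with p ℕ.≟ suc m
        ... | yes refl = let isPod′ , ps≤m′ = remove isPod in
          ∈-++⁺ʳ (bounded m (suc m + n)) (∈-map⁺ (suc m ∷_)
            (from ∈-bounded ((isPod′ , ℕ.+-cancelˡ-≡ (suc m) _ _ sum≡) , ps≤m′)))
        ... | no p≢ = ∈-++⁺ˡ (from ∈-bounded ((isPod , sum≡) , p≤m
                ∷ All.map (λ q≤p → ℕ.≤-trans q≤p p≤m) (head-bounds (proj₁ (proj₁ isPod)))))
          where p≤m = ℕ.≤-pred (ℕ.≤∧≢⇒< p≤ p≢)

      unsplit : ∀ {ps} → ps ∈ bounded m (suc m + n) ++ with-part → ps ∈ bounded (suc m) (suc m + n)
      unsplit ps∈ with ∈-++⁻ (bounded m (suc m + n)) ps∈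
      ... | inj₁ ps∈₁ = let isPodOf , ps≤ = to (∈-bounded {m}) ps∈₁ in
        from ∈-bounded (isPodOf , All.map ℕ.m≤n⇒m≤1+n ps≤)
      ... | inj₂ ps∈₂ with ∈-map⁻ (suc m ∷_) ps∈₂
      ... | qs , qs∈ , refl =
        let (isPod , sum≡) , qs≤ = to (∈-bounded {m′}) qs∈
            isPod′ , qs≤′ = insert isPod qs≤
        in from ∈-bounded ((isPod′ , cong (λ k → suc m + k) sum≡) , ℕ.≤-refl ∷ qs≤′)

  -- An odd part m + 1 occurs at most once, so after its removal the bound drops to m; in
  -- `count-even` the part may repeat and the bound stays.
  count-odd : ∀ m → Odd (suc m) → ∀ n → count (suc m) (suc m + n) ≡ count m (suc m + n) + count m n
  count-odd m odd = LargestPart.count-split m m remove insert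
    where
    remove : ∀ {ps} → IsPod (suc m ∷ ps) → IsPod ps × All (_≤ m) ps
    remove {ps} ((linked , _ ∷ pos) , distinct)
      -- Distinctness constrains the odd parts only, but a later part equal to the odd m + 1 would
      -- be among them; so `fresh` sharpens the bound from m + 1 to m.
      with fresh ∷ distinct′ ← subst Unique (filter-accept odd? odd) distinct =
      ((Linked.tail linked , pos) , distinct′) ,
      All.tabulate (λ p∈ → ℕ.≤-pred (ℕ.≤∧≢⇒< (All.lookup (head-bounds linked) p∈)
        (λ p≡ → All.lookup fresh (∈-filter⁺ odd? p∈ (subst Odd (sym p≡) odd)) (sym p≡))))
    insert : ∀ {ps} → IsPod ps → All (_≤ m) ps → IsPod (suc m ∷ ps) × All (_≤ suc m) ps
    insert {ps} ((linked , pos) , distinct) ps≤ =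
      ((∷-linked ps≤′ linked , s≤s z≤n ∷ pos) ,
        subst Unique (sym (filter-accept odd? odd))
          (All.tabulate (λ p∈ → λ { refl →
          ℕ.<-irrefl refl (All.lookup ps≤ (proj₁ (∈-filter⁻ odd? {xs = ps} p∈))) }) ∷ distinct)) ,
      ps≤′
      where ps≤′ = All.map ℕ.m≤n⇒m≤1+n ps≤

  count-even : ∀ m → ¬ Odd (suc m) → ∀ n → count (suc m) (suc m + n) ≡ count m (suc m + n) + count (suc m) n
  count-even m even = LargestPart.count-split m (suc m) remove insert
    where
    remove : ∀ {ps} → IsPod (suc m ∷ ps) → IsPod ps × All (_≤ suc m) ps
    remove ((linked , _ ∷ pos) , distinct) =
      ((Linked.tail linked , pos) , subst Unique (filter-reject odd? even) distinct) , head-bounds linked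
    insert : ∀ {ps} → IsPod ps → All (_≤ suc m) ps → IsPod (suc m ∷ ps) × All (_≤ suc m) ps
    insert ((linked , pos) , distinct) ps≤ =
      ((∷-linked ps≤ linked , s≤s z≤n ∷ pos) , subst Unique (sym (filter-reject odd? even)) distinct) , ps≤

  module _ {A B : Set} where

    -- Built by the recursion of the Cauchy product `_⊛_`, so that its lengths give a product of
    -- series by plain induction.
    convolution : (ℕ → List A) → (ℕ → List B) → ℕ → List (A × B)
    convolution X Y zero    = cartesianProduct (X 0) (Y 0)
    convolution X Y (suc n) = cartesianProduct (X 0) (Y (suc n)) ++ convolution (X ∘ suc) Y n

    ∈-convolution⁻ : ∀ X Y n {x y} → (x , y) ∈ convolution X Y n → ∃₂ λ i j → i + j ≡ n × x ∈ X i × y ∈ Y j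
    ∈-convolution⁻ X Y zero xy∈ = 0 , 0 , refl , ∈-cartesianProduct⁻ (X 0) (Y 0) xy∈
    ∈-convolution⁻ X Y (suc n) xy∈ with ∈-++⁻ (cartesianProduct (X 0) (Y (suc n))) xy∈
    ... | inj₁ xy∈₁ = 0 , suc n , refl , ∈-cartesianProduct⁻ (X 0) (Y (suc n)) xy∈₁
    ... | inj₂ xy∈₂ with i , j , refl , x∈ , y∈ ← ∈-convolution⁻ (X ∘ suc) Y n xy∈₂ =
      suc i , j , refl , x∈ , y∈

    ∈-convolution⁺ : ∀ X Y i j {x y} → x ∈ X i → y ∈ Y j → (x , y) ∈ convolution X Y (i + j)
    ∈-convolution⁺ X Y zero    zero    x∈ y∈ = ∈-cartesianProduct⁺ x∈ y∈
    ∈-convolution⁺ X Y zero    (suc j) x∈ y∈ = ∈-++⁺ˡ (∈-cartesianProduct⁺ x∈ y∈)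
    ∈-convolution⁺ X Y (suc i) j       x∈ y∈ =
      ∈-++⁺ʳ (cartesianProduct (X 0) (Y (suc (i + j)))) (∈-convolution⁺ (X ∘ suc) Y i j x∈ y∈)

    -- The blocks are disjoint because `graded` lets an element of `X i` determine its index i; for
    -- partitions the index is the sum.
    convolution-unique : ∀ X Y → (∀ i → Unique (X i)) → (∀ j → Unique (Y j)) →
      (∀ {i j x} → x ∈ X i → x ∈ X j → i ≡ j) → ∀ n → Unique (convolution X Y n)
    convolution-unique X Y X! Y! graded zero    = Unique.cartesianProduct⁺ (X! 0) (Y! 0)
    convolution-unique X Y X! Y! graded (suc n) = Unique.++⁺
      (Unique.cartesianProduct⁺ (X! 0) (Y! (suc n)))
      (convolution-unique (X ∘ suc) Y (X! ∘ suc) Y! (λ x∈ x∈′ → ℕ.suc-injective (graded x∈ x∈′)) n)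
      disjoint
      where
      disjoint : ∀ {xy} → ¬ (xy ∈ cartesianProduct (X 0) (Y (suc n)) × xy ∈ convolution (X ∘ suc) Y n)
      disjoint {x , y} (xy∈ , xy∈′)
        with x∈ , _ ← ∈-cartesianProduct⁻ (X 0) (Y (suc n)) xy∈
           | i , _ , _ , x∈′ , _ ← ∈-convolution⁻ (X ∘ suc) Y n xy∈′
        with () ← graded x∈ x∈′

    length-cartesianProduct : ∀ (xs : List A) (ys : List B) → length (cartesianProduct xs ys) ≡ length xs * length ys
    length-cartesianProduct []       ys = refl
    length-cartesianProduct (x ∷ xs) ys = trans (length-++ (map (x ,_) ys))
      (cong₂ _+_ (length-map (x ,_) ys) (length-cartesianProduct xs ys))

  podPairs : ℕ → List (List ℕ × List ℕ)
  podPairs = convolution podPartitions podPartitions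

  pod₋₃-convolution : ∀ n → pod₋₃ n ≡ length (convolution podPartitions podPairs n)
  pod₋₃-convolution n = unique⇒length≡ (podTriples-unique n)
    (convolution-unique podPartitions podPairs podPartitions-unique
      (convolution-unique podPartitions podPartitions podPartitions-unique podPartitions-unique graded) graded n)
    (mk⇔ (λ t∈ → forth (to (∈-podTriples {n}) t∈)) (λ t∈ → from ∈-podTriples (back n t∈)))
    where
    graded : ∀ {i j ps} → ps ∈ podPartitions i → ps ∈ podPartitions j → i ≡ j
    graded {i} {j} ps∈ ps∈′ =
      trans (sym (proj₂ (to (∈-podPartitions {i}) ps∈))) (proj₂ (to (∈-podPartitions {j}) ps∈′))

    forth : ∀ {n t} → IsPodTripleOf n t → t ∈ convolution podPartitions podPairs n
    forth {t = ps , qs , rs} ((isPod-ps , isPod-qs , isPod-rs) , refl) =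
      ∈-convolution⁺ podPartitions podPairs (sum ps) (sum qs + sum rs) (from ∈-podPartitions (isPod-ps , refl))
        (∈-convolution⁺ podPartitions podPartitions (sum qs) (sum rs)
          (from ∈-podPartitions (isPod-qs , refl)) (from ∈-podPartitions (isPod-rs , refl)))

    back : ∀ n {t} → t ∈ convolution podPartitions podPairs n → IsPodTripleOf n t
    back n t∈
      with i , j , refl , ps∈ , qrs∈ ← ∈-convolution⁻ podPartitions podPairs n t∈
      with k , l , refl , qs∈ , rs∈ ← ∈-convolution⁻ podPartitions podPartitions j qrs∈
      with isPod-ps , refl ← to (∈-podPartitions {i}) ps∈
         | isPod-qs , refl ← to (∈-podPartitions {k}) qs∈
         | isPod-rs , refl ← to (∈-podPartitions {l}) rs∈ = (isPod-ps , isPod-qs , isPod-rs) , refl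

open Enumeration

-- Congruences between integers

infix 4 _≡_mod_
record _≡_mod_ (i j : ℤ) (m : ℕ) : Set where
  constructor congruent
  field modulus∣difference : + m ℤ.∣ i ℤ.- j

module _ where
  open Data.Integer.Solver.+-*-Solver

  module Modular (m : ℕ) where
    by : ∀ {i j d} → i ℤ.- j ≡ d → + m ℤ.∣ d → i ≡ j mod m
    by ≡.refl m∣d = congruent m∣d

    mod-reflexive : ∀ {i j} → i ≡ j → i ≡ j mod m
    mod-reflexive {i} ≡.refl = by (ℤ.+-inverseʳ i) (divides (+ 0) ≡.refl)

    mod-sym : ∀ {i j} → i ≡ j mod m → j ≡ i mod m
    mod-sym {i} {j} (congruent i≡j) = by
      (solve 2 (λ i j → j :- i := :- (i :- j)) ≡.refl i j) (∣m⇒∣-m i≡j)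

    mod-trans : ∀ {i j k} → i ≡ j mod m → j ≡ k mod m → i ≡ k mod m
    mod-trans {i} {j} {k} (congruent i≡j) (congruent j≡k) = by
      (solve 3 (λ i j k → i :- k := (i :- j) :+ (j :- k)) ≡.refl i j k) (∣m∣n⇒∣m+n i≡j j≡k)

    mod-+ : ∀ {i i′ j j′} → i ≡ i′ mod m → j ≡ j′ mod m → i ℤ.+ j ≡ i′ ℤ.+ j′ mod m
    mod-+ {i} {i′} {j} {j′} (congruent i≡) (congruent j≡) = by
      (solve 4 (λ i i′ j j′ → (i :+ j) :- (i′ :+ j′) := (i :- i′) :+ (j :- j′)) ≡.refl i i′ j j′)
      (∣m∣n⇒∣m+n i≡ j≡)

    mod-neg : ∀ {i i′} → i ≡ i′ mod m → ℤ.- i ≡ ℤ.- i′ mod m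
    mod-neg {i} {i′} (congruent i≡) = by
      (solve 2 (λ i i′ → (:- i) :- (:- i′) := :- (i :- i′)) ≡.refl i i′) (∣m⇒∣-m i≡)

    mod-* : ∀ {i i′ j j′} → i ≡ i′ mod m → j ≡ j′ mod m → i ℤ.* j ≡ i′ ℤ.* j′ mod m
    mod-* {i} {i′} {j} {j′} (congruent i≡) (congruent j≡) = by
      (solve 4 (λ i i′ j j′ → i :* j :- i′ :* j′ := (i :- i′) :* j :+ i′ :* (j :- j′)) ≡.refl i i′ j j′)
      (∣m∣n⇒∣m+n (∣m⇒∣m*n j i≡) (∣n⇒∣m*n i′ j≡))

    ring : CommutativeRing 0ℓ 0ℓ
    ring = record
      { Carrier = ℤ
      ; _≈_ = λ i j → i ≡ j mod m
      ; _+_ = ℤ._+_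
      ; _*_ = ℤ._*_
      ; -_ = ℤ.-_
      ; 0# = + 0
      ; 1# = + 1
      ; isCommutativeRing = record
        { isRing = record
          { +-isAbelianGroup = record
            { isGroup = record
              { isMonoid = record
                { isSemigroup = record
                  { isMagma = record
                    { isEquivalence = record
                      { refl = mod-reflexive ≡.refl ; sym = mod-sym ; trans = mod-trans }
                    ; ∙-cong = mod-+
                    }
                  ; assoc = λ i j k → mod-reflexive (ℤ.+-assoc i j k)
                  }
                ; identity = (λ i → mod-reflexive (ℤ.+-identityˡ i)) , (λ i → mod-reflexive (ℤ.+-identityʳ i))
                }
              ; inverse = (λ i → mod-reflexive (ℤ.+-inverseˡ i)) , (λ i → mod-reflexive (ℤ.+-inverseʳ i))
              ; ⁻¹-cong = mod-neg
              }
            ; comm = λ i j → mod-reflexive (ℤ.+-comm i j)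
            }
          ; *-cong = mod-*
          ; *-assoc = λ i j k → mod-reflexive (ℤ.*-assoc i j k)
          ; *-identity = (λ i → mod-reflexive (ℤ.*-identityˡ i)) , (λ i → mod-reflexive (ℤ.*-identityʳ i))
          ; distrib = (λ i j k → mod-reflexive (ℤ.*-distribˡ-+ i j k)) , (λ i j k → mod-reflexive (ℤ.*-distribʳ-+ i j k))
          }
        ; *-comm = λ i j → mod-reflexive (ℤ.*-comm i j)
        }
      }

  ∣⇒%≡ : ∀ {m a b} .{{_ : NonZero m}} → a ≤ b → m ℕ.∣ b ℕ.∸ a → a % m ≡ b % m
  ∣⇒%≡ {m} {a} {b} a≤b (ℕ.divides k b∸a≡km) = ≡.sym (begin
    b % m                   ≡⟨ ≡.cong (_% m) (ℕ.m+[n∸m]≡n a≤b) ⟨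
    (a ℕ.+ (b ℕ.∸ a)) % m   ≡⟨ ≡.cong (λ d → (a ℕ.+ d) % m) b∸a≡km ⟩
    (a ℕ.+ k ℕ.* m) % m     ≡⟨ [m+kn]%n≡m%n a k m ⟩
    a % m                   ∎)
    where open ≡.≡-Reasoning

  ≤-mod⇒% : ∀ {m a b} .{{_ : NonZero m}} → a ≤ b → + b ≡ + a mod m → a % m ≡ b % m
  ≤-mod⇒% {m} {a} {b} a≤b (congruent m∣) = ∣⇒%≡ a≤b (≡.subst (m ℕ.∣_)
    (≡.trans (≡.cong ℤ.∣_∣ (ℤ.m-n≡m⊖n b a)) (≡.cong ℤ.∣_∣ (ℤ.⊖-≥ a≤b))) (∣⇒∣ᵤ m∣))

  mod⇒% : ∀ {m a b} .{{_ : NonZero m}} → + a ≡ + b mod m → a % m ≡ b % m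
  mod⇒% {m} {a} {b} a≡b with ℕ.≤-total a b
  ... | inj₁ a≤b = ≤-mod⇒% a≤b (Modular.mod-sym m a≡b)
  ... | inj₂ b≤a = ≡.sym (≤-mod⇒% b≤a a≡b)

  i+i+i≡3i : ∀ i → i ℤ.+ i ℤ.+ i ≡ + 3 ℤ.* i
  i+i+i≡3i = solve 1 (λ i → i :+ i :+ i := con (+ 3) :* i) ≡.refl

  6i≡3[i+i] : ∀ i → + 6 ℤ.* i ≡ + 3 ℤ.* (i ℤ.+ i)
  6i≡3[i+i] = solve 1 (λ i → con (+ 6) :* i := con (+ 3) :* (i :+ i)) ≡.refl

  1+1≡0 : + 2 ≡ + 0 mod 2
  1+1≡0 = congruent (divides (+ 1) ≡.refl)

  1+1+1≡0 : + 3 ≡ + 0 mod 3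
  1+1+1≡0 = congruent (divides (+ 1) ≡.refl)

  cube-mod-3 : ∀ c → c ℤ.* c ℤ.* c ≡ c mod 3
  cube-mod-3 c = mod-trans (mod-* (mod-* c≡r c≡r) c≡r)
    (mod-trans (residue (c ℤ.%ℕ 3) (ℤ.n%ℕd<d c 3)) (mod-sym c≡r))
    where
    open Modular 3
    r = + (c ℤ.%ℕ 3)
    c≡r : c ≡ r mod 3
    c≡r = congruent (divides (c ℤ./ℕ 3) (≡.trans (≡.cong (ℤ._- r) (ℤ.a≡a%ℕn+[a/ℕn]*n c 3))
      (solve 2 (λ r d → (r :+ d :* con (+ 3)) :- r := d :* con (+ 3)) ≡.refl r (c ℤ./ℕ 3))))
    residue : ∀ r → r < 3 → + r ℤ.* + r ℤ.* + r ≡ + r mod 3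
    residue 0 _ = mod-reflexive ≡.refl
    residue 1 _ = mod-reflexive ≡.refl
    residue 2 _ = congruent (divides (+ 2) ≡.refl)
    residue (suc (suc (suc r))) (s≤s (s≤s (s≤s ())))

  -- From 1 = 3 - 2: a difference d = 2k = 3l equals 3d - 2d = 6k - 6l.
  mod-2∧3⇒6 : ∀ {i j} → i ≡ j mod 2 → i ≡ j mod 3 → i ≡ j mod 6
  mod-2∧3⇒6 {i} {j} (congruent (divides k i-j≡2k)) (congruent (divides l i-j≡3l)) = congruent (divides (k ℤ.- l) (begin
    i ℤ.- j                                   ≡⟨ solve 1 (λ d → d := con (+ 3) :* d :- con (+ 2) :* d) ≡.refl (i ℤ.- j) ⟩
    + 3 ℤ.* (i ℤ.- j) ℤ.- + 2 ℤ.* (i ℤ.- j)   ≡⟨ ≡.cong₂ (λ u v → + 3 ℤ.* u ℤ.- + 2 ℤ.* v) i-j≡2k i-j≡3l ⟩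
    + 3 ℤ.* (k ℤ.* + 2) ℤ.- + 2 ℤ.* (l ℤ.* + 3)
      ≡⟨ solve 2 (λ k l → con (+ 3) :* (k :* con (+ 2)) :- con (+ 2) :* (l :* con (+ 3)) := (k :- l) :* con (+ 6)) ≡.refl k l ⟩
    (k ℤ.- l) ℤ.* + 6                         ∎))
    where open ≡.≡-Reasoning

  3*-mod : ∀ {m i j} → i ≡ j mod m → + 3 ℤ.* i ≡ + 3 ℤ.* j mod (3 ℕ.* m)
  3*-mod {m} {i} {j} (congruent m∣) = Modular.by (3 ℕ.* m)
    (solve 2 (λ i j → con (+ 3) :* i :- con (+ 3) :* j := con (+ 3) :* (i :- j)) ≡.refl i j)
    (≡.subst (ℤ._∣ _) (≡.sym (ℤ.pos-* 3 m)) (*-monoʳ-∣ (+ 3) m∣))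

-- Opaque, so that type checking never enumerates partitions.
opaque
  podSeries : ℕ → ℤ
  podSeries n = + pod n

  podSeries≡ : ∀ n → podSeries n ≡ + pod n
  podSeries≡ n = ≡.refl

-- The series W₁ and W₂ of Theta.Reciprocal, stated independently of the modulus.
module _ where
  open RawSeries ℤ._+_ ℤ._*_

  private
    q p₀ p₁ p₂ : ℕ → ℤ
    q    = cons (+ 0) (cons (+ 1) λ _ → + 0)
    p₀ n = podSeries (n ℕ.* 3)
    p₁ n = podSeries (1 ℕ.+ n ℕ.* 3)
    p₂ n = podSeries (2 ℕ.+ n ℕ.* 3)

    infixl 6 _⊞_
    _⊞_ : (ℕ → ℤ) → (ℕ → ℤ) → ℕ → ℤ
    (f ⊞ g) n = f n ℤ.+ g n

  weight₁ weight₂ : ℕ → ℤ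
  weight₁ = p₀ ⊛ p₀ ⊛ p₁ ⊞ q ⊛ (p₀ ⊛ p₂ ⊛ p₂ ⊞ p₁ ⊛ p₁ ⊛ p₂)
  weight₂ = p₀ ⊛ p₀ ⊛ p₂ ⊞ p₀ ⊛ p₁ ⊛ p₁ ⊞ q ⊛ (p₁ ⊛ p₂ ⊛ p₂)

module PodSeries (m : ℕ) where
  open PowerSeries (Modular.ring m) public
  private module R = CommutativeRing (Modular.ring m)
  open CommutativeRing seriesRing hiding (zero) public
  open Algebra.Properties.Semiring.Exp semiring
  open Theta (Modular.ring m)

  ofSizes : {A : Set} → (ℕ → List A) → Series
  ofSizes X n = + length (X n)

  ofSizes-convolution : ∀ {A B : Set} (X : ℕ → List A) (Y : ℕ → List B) →
                        ofSizes (convolution X Y) ≈ ofSizes X * ofSizes Y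
  ofSizes-convolution X Y .at n = R.reflexive (go X Y n)
    where
    length≡ : ∀ {A B : Set} (xs : List A) (ys : List B) →
              + length (cartesianProduct xs ys) ≡ + length xs ℤ.* + length ys
    length≡ xs ys = ≡.trans (≡.cong +_ (length-cartesianProduct xs ys)) (ℤ.pos-* (length xs) (length ys))
    go : ∀ {A B : Set} (X : ℕ → List A) (Y : ℕ → List B) n →
         + length (convolution X Y n) ≡ (ofSizes X * ofSizes Y) n
    go X Y zero    = length≡ (X 0) (Y 0)
    go X Y (suc n) = ≡.trans
      (≡.cong +_ (length-++ (cartesianProduct (X 0) (Y (suc n)))))
      (≡.cong₂ ℤ._+_ (length≡ (X 0) (Y (suc n))) (go (X ∘ suc) Y n))

  P : Series
  P = podSeries

  ofSizes-pod : ofSizes podPartitions ≈ P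
  ofSizes-pod .at n = R.reflexive (≡.sym (podSeries≡ n))

  P³ : ∀ n → + pod₋₃ n R.≈ (P * (P * P)) n
  P³ n = R.trans (R.reflexive (≡.cong +_ (pod₋₃-convolution n))) (eq .at n)
    where
    eq : ofSizes (convolution podPartitions podPairs) ≈ P * (P * P)
    eq = trans (ofSizes-convolution podPartitions podPairs) (*-cong ofSizes-pod
      (trans (ofSizes-convolution podPartitions podPartitions) (*-cong ofSizes-pod ofSizes-pod)))

  B : ℕ → Series
  B k = ofSizes (bounded k)

  B-zero : B 0 ≈ 1#
  B-zero .at zero    = R.reflexive (≡.cong +_ count-0-0)
  B-zero .at (suc n) = R.reflexive (≡.cong +_ (count-0-suc n))

  B-suc : ∀ k k′ → (∀ n → count (suc k) (suc k ℕ.+ n) ≡ count k (suc k ℕ.+ n) ℕ.+ count k′ n) →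
          B (suc k) ≈ B k + q ^ suc k * B k′
  B-suc k k′ split = shift-recurrence (suc k)
    (λ n n<k → R.reflexive (≡.cong +_ (count-suc-< (ℕ.≤-pred n<k))))
    (λ n → R.reflexive (≡.cong +_ (split n)))

  odd-suc : ∀ n → Odd (suc (n ℕ.* 2))
  odd-suc n 2∣1+2n = contradiction
    (ℕ.∣⇒≤ (ℕ.∣m+n∣m⇒∣n (≡.subst (2 ℕ.∣_) (ℕ.+-comm 1 (n ℕ.* 2)) 2∣1+2n) (ℕ.divides n ≡.refl)))
    (ℕ.<⇒≱ (s≤s (s≤s z≤n)))

  open Reciprocal P B B-zero
    (λ n → B-suc (n ℕ.* 2) (n ℕ.* 2) (count-odd (n ℕ.* 2) (odd-suc n)))
    (λ n → B-suc (suc (n ℕ.* 2)) (suc n ℕ.* 2)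
      (count-even (suc (n ℕ.* 2)) λ odd → odd (ℕ.divides (suc n) ≡.refl)))
    (λ k → below λ n n<k → R.reflexive (≡.trans (≡.cong +_ (count-≤ (ℕ.<⇒≤ n<k))) (≡.sym (podSeries≡ n))))
    public

  -- Valid for every modulus; with modulus 18 it leaves `weight₁` to be determined modulo 6 only.
  pod₋₃-1+3n : ∀ n → + pod₋₃ (1 ℕ.+ n ℕ.* 3) R.≈ + 3 R.* weight₁ n
  pod₋₃-1+3n n = R.trans (P³ (1 ℕ.+ n ℕ.* 3)) (R.trans (U₁-P³ .at n) (R.reflexive (i+i+i≡3i (weight₁ n))))

  pod₋₃-2+3n : ∀ n → + pod₋₃ (2 ℕ.+ n ℕ.* 3) R.≈ + 3 R.* weight₂ n
  pod₋₃-2+3n n = R.trans (P³ (2 ℕ.+ n ℕ.* 3)) (R.trans (U₂-P³ .at n) (R.reflexive (i+i+i≡3i (weight₂ n))))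

-- Assembling the two congruences

weight₁-mod-2 : ∀ n → weight₁ n ≡ podSeries (2 ℕ.+ n ℕ.* 3 ℕ.* 3) mod 2
weight₁-mod-2 n = at (Mod2.W₁≈U₀U₂P 1+1≡0) n
  where open PodSeries 2

weight₁-mod-3 : ∀ n → weight₁ n ≡ podSeries (2 ℕ.+ n ℕ.* 3 ℕ.* 3) mod 3
weight₁-mod-3 n = at (Mod3.W₁≈U₀U₂P 1+1+1≡0 cube-mod-3) n
  where open PodSeries 3

weight₂-mod-3 : ∀ n → weight₂ n ≡ podSeries (2 ℕ.+ (1 ℕ.+ n ℕ.* 3) ℕ.* 3)
                                ℤ.+ podSeries (2 ℕ.+ (1 ℕ.+ n ℕ.* 3) ℕ.* 3) mod 3
weight₂-mod-3 n = at (Mod3.W₂≈2U₁U₂P 1+1+1≡0 cube-mod-3) n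
  where open PodSeries 3

-- The indices are variables i and j because the type checker would start enumerating
-- partitions at indices in successor form.
pod₋₃-mod-18 : ∀ n {i j} → 1 ℕ.+ n ℕ.* 3 ≡ i → 2 ℕ.+ n ℕ.* 3 ℕ.* 3 ≡ j →
               pod₋₃ i % 18 ≡ (3 ℕ.* pod j) % 18
pod₋₃-mod-18 n {i} {j} i≡ j≡ = go
  (≡.subst (λ i → + pod₋₃ i ≡ + 3 ℤ.* weight₁ n mod 18) i≡ (PodSeries.pod₋₃-1+3n 18 n))
  (mod-2∧3⇒6 (weight₁-mod-2 n) (weight₁-mod-3 n)) (≡.trans (≡.cong podSeries j≡) (podSeries≡ j))
  where
  go : ∀ {a c w v} → + a ≡ + 3 ℤ.* w mod 18 → w ≡ v mod 6 → v ≡ + c → a % 18 ≡ (3 ℕ.* c) % 18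
  go {c = c} a≡3w w≡v ≡.refl =
    mod⇒% (mod-trans a≡3w (mod-trans (3*-mod w≡v) (mod-reflexive (≡.sym (ℤ.pos-* 3 c)))))
    where open Modular 18

pod₋₃-mod-9 : ∀ n {i j} → 2 ℕ.+ n ℕ.* 3 ≡ i → 2 ℕ.+ (1 ℕ.+ n ℕ.* 3) ℕ.* 3 ≡ j →
              pod₋₃ i % 9 ≡ (6 ℕ.* pod j) % 9
pod₋₃-mod-9 n {i} {j} i≡ j≡ = go
  (≡.subst (λ i → + pod₋₃ i ≡ + 3 ℤ.* weight₂ n mod 9) i≡ (PodSeries.pod₋₃-2+3n 9 n))
  (weight₂-mod-3 n) (≡.trans (≡.cong podSeries j≡) (podSeries≡ j))
  where
  go : ∀ {a c w v} → + a ≡ + 3 ℤ.* w mod 9 → w ≡ v ℤ.+ v mod 3 → v ≡ + c → a % 9 ≡ (6 ℕ.* c) % 9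
  go {c = c} a≡3w w≡v+v ≡.refl = mod⇒% (mod-trans a≡3w (mod-trans (3*-mod w≡v+v)
    (mod-reflexive (≡.trans (≡.sym (6i≡3[i+i] (+ c))) (≡.sym (ℤ.pos-* 6 c))))))
    where open Modular 9

open import Data.Nat.Base using (_+_; _*_)
open import Data.Product.Base using (_×_)

theorem3p1 : (n : ℕ) →
    (pod₋₃ (3 * n + 2) % 9 ≡ (6 * pod (9 * n + 5)) % 9) ×
    (pod₋₃ (3 * n + 1) % 18 ≡ (3 * pod (9 * n + 2)) % 18)
theorem3p1 n =
  pod₋₃-mod-9 n 2+n*3≡ 5+n*9≡ , pod₋₃-mod-18 n 1+n*3≡ 2+n*9≡
  where
  open Data.Nat.Solver.+-*-Solver
  2+n*3≡ : 2 + n * 3 ≡ 3 * n + 2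
  2+n*3≡ = solve 1 (λ n → con 2 :+ n :* con 3 := con 3 :* n :+ con 2) ≡.refl n
  5+n*9≡ : 2 + (1 + n * 3) * 3 ≡ 9 * n + 5
  5+n*9≡ = solve 1 (λ n → con 2 :+ (con 1 :+ n :* con 3) :* con 3 := con 9 :* n :+ con 5) ≡.refl n
  1+n*3≡ : 1 + n * 3 ≡ 3 * n + 1
  1+n*3≡ = solve 1 (λ n → con 1 :+ n :* con 3 := con 3 :* n :+ con 1) ≡.refl n
  2+n*9≡ : 2 + n * 3 * 3 ≡ 9 * n + 2
  2+n*9≡ = solve 1 (λ n → con 2 :+ n :* con 3 :* con 3 := con 9 :* n :+ con 2) ≡.refl n
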